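{- Let $\Gamma$ be a simple digraph of order $n\ge 2$. Then $\operatorname{sp}(\Gamma)=0$ if and only if $\Gamma$ is a $k$-imploding star (for some $k\in\{0,1,\dots,n\}$) or a regular tournament.
   Context: A simple digraph $\Gamma=(V,E)$ of order $n$ has vertex set $V=\{1,\dots,n\}$ and edge set $E\subseteq V\times V$ with no loops and no multi-edges (both $(i,j)$ and $(j,i)$ may be edges). Its adjacency matrix is $A=[a_{ij}]$ with $a_{ij}=1$ if $(i,j)\in E$ and $a_{ij}=0$ otherwise, and its Laplacian matrix is $L=D-A$, where $D$ is the diagonal matrix whose $i$th diagonal entry is the out-degree $d^+(i)$ (the number of edges of the form $(i,j)\in E$). Let $\mathbf{e}$ be the all ones vector in $\mathbb{R}^n$. For $n\ge 2$ define \[ \alpha(\Gamma)=\min_{\mathbf{x}\in\mathbb{R}^n,\ \mathbf{x}\perp\mathbf{e},\ \|\mathbf{x}\|=1}\mathbf{x}^TL\mathbf{x},\qquad \beta(\Gamma)=\max_{\mathbf{x}\in\mathbb{R}^n,\ \mathbf{x}\perp\mathbf{e},\ \|\mathbf{x}\|=1}\mathbf{x}^TL\mathbf{x}, \] where $\|\cdot\|$ is the Euclidean norm. The Laplacian spread is $\operatorname{sp}(\Gamma)=\beta(\Gamma)-\alpha(\Gamma)$. $K_m$ denotes the complete digraph of order $m$ (all ordered pairs of distinct vertices are edges) and $\overline{K_m}$ the empty digraph of order $m$ (no edges); $K_0=\overline{K_0}$ is the null digraph. The directed join of digraphs $\Gamma_1=(V_1,E_1)$ and $\Gamma_2=(V_2,E_2)$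 with $V_1\cap V_2=\emptyset$ is the digraph with vertex set $V_1\sqcup V_2$ and edge set $E_1\sqcup E_2\sqcup\{(i,j): i\in V_1,\ j\in V_2\}$. For $k\in\{0,1,\dots,n\}$, the $k$-imploding star of order $n$ is the directed join of $\overline{K_{n-k}}$ (first) and $K_k$ (second). A regular tournament of order $n$, where $n\ge3$ is odd, is a tournament digraph (for each pair of distinct vertices $i,j$ exactly one of $(i,j),(j,i)$ is an edge) in which each vertex has in-degree and out-degree equal to $(n-1)/2$. Digraphs are considered up to isomorphism. -}

module Defs where

open import Algebra.Bundles.Raw using (RawRing)
import Algebra.Definitions.RawMonoid as RawMonoidDefinitions
open import Data.Bool.Base using (Bool; true; false; not; if_then_else_)
open import Data.Fin.Base using (Fin; splitAt)
open import Data.Fin.Properties using (_≟_)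
open import Data.Fin.Subset using (Subset; ∣_∣)
open import Data.Integer.Base using (+_)
open import Data.Nat.Base as ℕ using (ℕ)
open import Data.Nat.DivMod using (_/_; _%_)
import Data.Nat.Properties as ℕₚ
open import Data.Product.Base using (Σ; _×_; _,_; ∃; ∃-syntax; ∃₂)
open import Data.Rational.Base as ℚ using (ℚ; 0ℚ; 1ℚ; ½)
import Data.Rational.Properties as ℚₚ
import Data.Rational.Solver as ℚ-Solver
open import Data.Sum.Base using (_⊎_; inj₁; inj₂)
open import Data.Vec.Base using (tabulate)
open import Data.Vec.Functional using (Vector)
open import Function.Bundles using (_↔_; Inverse)
open import Level using (0ℓ)
open import Relation.Binary.PropositionalEquality
open import Relation.Nullary.Decidable using (does; yes; no)
open import Relation.Nullary.Negation using (contradiction)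

private
  variable
    m n k : ℕ

------------------------------------------------------------------------
-- Real numbers

-- A real number is a Cauchy sequence of rationals.  Two sequences denote
-- the same real when they satisfy _≈_ below, so _≈_ (and not _≡_) is
-- equality of reals.

IsCauchy : (ℕ → ℚ) → Set
IsCauchy s = ∀ ε → 0ℚ ℚ.< ε →
  ∃[ N ] ∀ i j → N ℕ.≤ i → N ℕ.≤ j → ℚ.∣ s i ℚ.- s j ∣ ℚ.< ε

record ℝ : Set where
  no-eta-equality
  field
    seq    : ℕ → ℚ
    cauchy : IsCauchy seq

open ℝ public

infix 4 _≈_ _≤_

-- Records, rather than plain definitions, so that x and y can be inferred.
record _≈_ (x y : ℝ) : Set where
  constructor mk≈
  field
    close : ∀ ε → 0ℚ ℚ.< ε →
      ∃[ N ] ∀ i → N ℕ.≤ i → ℚ.∣ seq x i ℚ.- seq y i ∣ ℚ.< ε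

record _≤_ (x y : ℝ) : Set where
  constructor mk≤
  field
    below : ∀ ε → 0ℚ ℚ.< ε →
      ∃[ N ] ∀ i → N ℕ.≤ i → seq x i ℚ.- seq y i ℚ.< ε

open _≈_ public
open _≤_ public

private
  open ℚ-Solver.+-*-Solver

  half-half : ∀ ε → ε ℚ.* ½ ℚ.+ ε ℚ.* ½ ≡ ε
  half-half ε = trans (sym (ℚₚ.*-distribˡ-+ ε ½ ½)) (ℚₚ.*-identityʳ ε)

  half-pos : ∀ {ε} → 0ℚ ℚ.< ε → 0ℚ ℚ.< ε ℚ.* ½
  half-pos {ε} 0<ε =
    subst (ℚ._< ε ℚ.* ½) (ℚₚ.*-zeroˡ ½) (ℚₚ.*-monoˡ-<-pos ½ 0<ε)

  const-cauchy : ∀ q → IsCauchy (λ _ → q)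
  const-cauchy q ε 0<ε = 0 , λ _ _ _ _ →
    subst (λ z → ℚ.∣ z ∣ ℚ.< ε) (sym (ℚₚ.+-inverseʳ q)) 0<ε

  +-cauchy : ∀ s t → IsCauchy s → IsCauchy t →
             IsCauchy (λ i → s i ℚ.+ t i)
  +-cauchy s t cs ct ε 0<ε
    with cs (ε ℚ.* ½) (half-pos 0<ε) | ct (ε ℚ.* ½) (half-pos 0<ε)
  ... | M , f | N , g = M ℕ.⊔ N , λ i j p q → begin-strict
      ℚ.∣ (s i ℚ.+ t i) ℚ.- (s j ℚ.+ t j) ∣
        ≡⟨ cong ℚ.∣_∣ (solve 4 (λ a b c d →
             (a :+ b) :- (c :+ d) := (a :- c) :+ (b :- d))
             refl (s i) (t i) (s j) (t j)) ⟩
      ℚ.∣ (s i ℚ.- s j) ℚ.+ (t i ℚ.- t j) ∣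
        ≤⟨ ℚₚ.∣p+q∣≤∣p∣+∣q∣ (s i ℚ.- s j) (t i ℚ.- t j) ⟩
      ℚ.∣ s i ℚ.- s j ∣ ℚ.+ ℚ.∣ t i ℚ.- t j ∣
        <⟨ ℚₚ.+-mono-<
             (f i j (ℕₚ.m⊔n≤o⇒m≤o M N p) (ℕₚ.m⊔n≤o⇒m≤o M N q))
             (g i j (ℕₚ.m⊔n≤o⇒n≤o M N p) (ℕₚ.m⊔n≤o⇒n≤o M N q)) ⟩
      ε ℚ.* ½ ℚ.+ ε ℚ.* ½
        ≡⟨ half-half ε ⟩
      ε ∎
    where open ℚₚ.≤-Reasoning

  neg-cauchy : ∀ s → IsCauchy s → IsCauchy (λ i → ℚ.- s i)
  neg-cauchy s cs ε 0<ε with cs ε 0<ε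
  ... | N , f = N , λ i j p q → begin-strict
      ℚ.∣ ℚ.- s i ℚ.- ℚ.- s j ∣
        ≡⟨ cong ℚ.∣_∣ (solve 2 (λ a b → :- a :- :- b := :- (a :- b))
             refl (s i) (s j)) ⟩
      ℚ.∣ ℚ.- (s i ℚ.- s j) ∣
        ≡⟨ ℚₚ.∣-p∣≡∣p∣ (s i ℚ.- s j) ⟩
      ℚ.∣ s i ℚ.- s j ∣
        <⟨ f i j p q ⟩
      ε ∎
    where open ℚₚ.≤-Reasoning

  eventually-bounded : ∀ s → IsCauchy s →
    ∃₂ λ B N → 0ℚ ℚ.< B × (∀ i → N ℕ.≤ i → ℚ.∣ s i ∣ ℚ.< B)
  eventually-bounded s cs with cs 1ℚ (ℚₚ.positive⁻¹ 1ℚ)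
  ... | N , f = 1ℚ ℚ.+ ℚ.∣ s N ∣ , N , 0<B , bound
    where
    open ℚₚ.≤-Reasoning
    0<B : 0ℚ ℚ.< 1ℚ ℚ.+ ℚ.∣ s N ∣
    0<B = ℚₚ.+-mono-<-≤ (ℚₚ.positive⁻¹ 1ℚ) (ℚₚ.0≤∣p∣ (s N))
    bound : ∀ i → N ℕ.≤ i → ℚ.∣ s i ∣ ℚ.< 1ℚ ℚ.+ ℚ.∣ s N ∣
    bound i p = begin-strict
      ℚ.∣ s i ∣
        ≡⟨ cong ℚ.∣_∣ (solve 2 (λ a b → a := (a :- b) :+ b)
             refl (s i) (s N)) ⟩
      ℚ.∣ (s i ℚ.- s N) ℚ.+ s N ∣
        ≤⟨ ℚₚ.∣p+q∣≤∣p∣+∣q∣ (s i ℚ.- s N) (s N) ⟩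
      ℚ.∣ s i ℚ.- s N ∣ ℚ.+ ℚ.∣ s N ∣
        <⟨ ℚₚ.+-monoˡ-< ℚ.∣ s N ∣ (f i N p ℕₚ.≤-refl) ⟩
      1ℚ ℚ.+ ℚ.∣ s N ∣ ∎

  *-mono-≤-∣∣ : ∀ a b {A B} → ℚ.∣ a ∣ ℚ.< A → ℚ.∣ b ∣ ℚ.< B →
                ℚ.∣ a ℚ.* b ∣ ℚ.≤ A ℚ.* B
  *-mono-≤-∣∣ a b {A} {B} p q = begin
      ℚ.∣ a ℚ.* b ∣
        ≡⟨ ℚₚ.∣p*q∣≡∣p∣*∣q∣ a b ⟩
      ℚ.∣ a ∣ ℚ.* ℚ.∣ b ∣
        ≤⟨ ℚₚ.*-monoˡ-≤-nonNeg ℚ.∣ a ∣ {{ℚ.nonNegative (ℚₚ.0≤∣p∣ a)}}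
             (ℚₚ.<⇒≤ q) ⟩
      ℚ.∣ a ∣ ℚ.* B
        ≤⟨ ℚₚ.*-monoʳ-≤-nonNeg B
             {{ℚ.nonNegative (ℚₚ.≤-trans (ℚₚ.0≤∣p∣ b) (ℚₚ.<⇒≤ q))}}
             (ℚₚ.<⇒≤ p) ⟩
      A ℚ.* B ∎
    where open ℚₚ.≤-Reasoning

  -- For 0 < C there is δ > 0 with C * δ = ε.
  quotient : ∀ {ε C} → 0ℚ ℚ.< ε → 0ℚ ℚ.< C →
             ∃[ δ ] 0ℚ ℚ.< δ × C ℚ.* δ ≡ ε
  quotient {ε} {C} 0<ε 0<C = ε ℚ.* C⁻¹ , 0<δ , eq
    where
    instance
      C-pos : ℚ.Positive C
      C-pos = ℚ.positive 0<C
      C≢0 : ℚ.NonZero C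
      C≢0 = ℚₚ.pos⇒nonZero C
    C⁻¹ : ℚ
    C⁻¹ = ℚ.1/ C
    0<δ : 0ℚ ℚ.< ε ℚ.* C⁻¹
    0<δ = subst (ℚ._< ε ℚ.* C⁻¹) (ℚₚ.*-zeroˡ C⁻¹)
            (ℚₚ.*-monoˡ-<-pos C⁻¹ {{ℚₚ.1/pos⇒pos C}} 0<ε)
    eq : C ℚ.* (ε ℚ.* C⁻¹) ≡ ε
    eq = trans (solve 3 (λ c e d → c :* (e :* d) := e :* (c :* d))
                  refl C ε C⁻¹)
        (trans (cong (ε ℚ.*_) (ℚₚ.*-inverseʳ C)) (ℚₚ.*-identityʳ ε))

  ∣ab-cd∣≤ : ∀ a b c d {A B δ} →
    ℚ.∣ a ∣ ℚ.< A → ℚ.∣ d ∣ ℚ.< B →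
    ℚ.∣ a ℚ.- c ∣ ℚ.< δ → ℚ.∣ b ℚ.- d ∣ ℚ.< δ →
    ℚ.∣ a ℚ.* b ℚ.- c ℚ.* d ∣ ℚ.≤ (A ℚ.+ B) ℚ.* δ
  ∣ab-cd∣≤ a b c d {A} {B} {δ} a<A d<B a-c<δ b-d<δ = begin
      ℚ.∣ a ℚ.* b ℚ.- c ℚ.* d ∣
        ≡⟨ cong ℚ.∣_∣ (solve 4 (λ a b c d →
             a :* b :- c :* d := a :* (b :- d) :+ d :* (a :- c))
             refl a b c d) ⟩
      ℚ.∣ a ℚ.* (b ℚ.- d) ℚ.+ d ℚ.* (a ℚ.- c) ∣
        ≤⟨ ℚₚ.∣p+q∣≤∣p∣+∣q∣ (a ℚ.* (b ℚ.- d)) (d ℚ.* (a ℚ.- c)) ⟩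
      ℚ.∣ a ℚ.* (b ℚ.- d) ∣ ℚ.+ ℚ.∣ d ℚ.* (a ℚ.- c) ∣
        ≤⟨ ℚₚ.+-mono-≤ (*-mono-≤-∣∣ a (b ℚ.- d) a<A b-d<δ)
                       (*-mono-≤-∣∣ d (a ℚ.- c) d<B a-c<δ) ⟩
      A ℚ.* δ ℚ.+ B ℚ.* δ
        ≡⟨ ℚₚ.*-distribʳ-+ δ A B ⟨
      (A ℚ.+ B) ℚ.* δ ∎
    where open ℚₚ.≤-Reasoning

  half-< : ∀ {ε} → 0ℚ ℚ.< ε → ε ℚ.* ½ ℚ.< ε
  half-< {ε} 0<ε = subst₂ ℚ._<_ (ℚₚ.+-identityʳ (ε ℚ.* ½)) (half-half ε)
    (ℚₚ.+-monoʳ-< (ε ℚ.* ½) (half-pos 0<ε))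

  *-cauchy : ∀ s t → IsCauchy s → IsCauchy t →
             IsCauchy (λ i → s i ℚ.* t i)
  *-cauchy s t cs ct ε 0<ε =
    let A , N₁ , 0<A , s<A = eventually-bounded s cs
        B , N₂ , 0<B , t<B = eventually-bounded t ct
        δ , 0<δ , eq = quotient {ε ℚ.* ½} {A ℚ.+ B}
                         (half-pos 0<ε) (ℚₚ.+-mono-< 0<A 0<B)
        N₃ , f = cs δ 0<δ
        N₄ , g = ct δ 0<δ
        L = N₁ ℕ.⊔ N₂
        R = N₃ ℕ.⊔ N₄
    in L ℕ.⊔ R , λ i j p q →
      let L≤i = ℕₚ.m⊔n≤o⇒m≤o L R p
          R≤i = ℕₚ.m⊔n≤o⇒n≤o L R p
          L≤j = ℕₚ.m⊔n≤o⇒m≤o L R q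
          R≤j = ℕₚ.m⊔n≤o⇒n≤o L R q
      in ℚₚ.≤-<-trans
           (subst (ℚ.∣ s i ℚ.* t i ℚ.- s j ℚ.* t j ∣ ℚ.≤_) eq
             (∣ab-cd∣≤ (s i) (t i) (s j) (t j)
               (s<A i (ℕₚ.m⊔n≤o⇒m≤o N₁ N₂ L≤i))
               (t<B j (ℕₚ.m⊔n≤o⇒n≤o N₁ N₂ L≤j))
               (f i j (ℕₚ.m⊔n≤o⇒m≤o N₃ N₄ R≤i) (ℕₚ.m⊔n≤o⇒m≤o N₃ N₄ R≤j))
               (g i j (ℕₚ.m⊔n≤o⇒n≤o N₃ N₄ R≤i) (ℕₚ.m⊔n≤o⇒n≤o N₃ N₄ R≤j))))
           (half-< 0<ε)

infixl 6 _+_ _-_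
infixl 7 _*_
infix  8 -_

fromℚ : ℚ → ℝ
fromℚ q .seq _  = q
fromℚ q .cauchy = const-cauchy q

fromℕ : ℕ → ℝ
fromℕ a = fromℚ (+ a ℚ./ 1)

0ℝ 1ℝ : ℝ
0ℝ = fromℚ 0ℚ
1ℝ = fromℚ 1ℚ

_+_ : ℝ → ℝ → ℝ
(x + y) .seq i  = seq x i ℚ.+ seq y i
(x + y) .cauchy = +-cauchy (seq x) (seq y) (cauchy x) (cauchy y)

-_ : ℝ → ℝ
(- x) .seq i  = ℚ.- seq x i
(- x) .cauchy = neg-cauchy (seq x) (cauchy x)

_-_ : ℝ → ℝ → ℝ
x - y = x + - y

_*_ : ℝ → ℝ → ℝ
(x * y) .seq i  = seq x i ℚ.* seq y i
(x * y) .cauchy = *-cauchy (seq x) (seq y) (cauchy x) (cauchy y)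

ℝ-rawRing : RawRing 0ℓ 0ℓ
ℝ-rawRing = record
  { Carrier = ℝ
  ; _≈_     = _≈_
  ; _+_     = _+_
  ; _*_     = _*_
  ; -_      = -_
  ; 0#      = 0ℝ
  ; 1#      = 1ℝ
  }

open RawMonoidDefinitions (RawRing.+-rawMonoid ℝ-rawRing) public using (sum)

------------------------------------------------------------------------
-- Vectors and matrices

Matrix : ℕ → Set
Matrix n = Fin n → Fin n → ℝ

infix 8 _·_ _*ᵥ_

_·_ : Vector ℝ n → Vector ℝ n → ℝ
x · y = sum (λ i → x i * y i)

_*ᵥ_ : Matrix n → Vector ℝ n → Vector ℝ n
(M *ᵥ x) i = sum (λ j → M i j * x j)

𝐞 : Vector ℝ n
𝐞 _ = 1ℝ

infix 4 _⊥_

_⊥_ : Vector ℝ n → Vector ℝ n → Set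
x ⊥ y = x · y ≈ 0ℝ

-- The Euclidean norm √(x · x), given by its graph: r is the nonnegative
-- square root of x · x.
‖_‖≈_ : Vector ℝ n → ℝ → Set
‖ x ‖≈ r = 0ℝ ≤ r × r * r ≈ x · x

-- IsMinimum P f a says that a = min { f x : P x }, the minimum being
-- attained; dually for IsMaximum.
module _ {A : Set} (P : A → Set) (f : A → ℝ) where

  IsMinimum : ℝ → Set
  IsMinimum a = (∃[ x ] P x × f x ≈ a) × (∀ x → P x → a ≤ f x)

  IsMaximum : ℝ → Set
  IsMaximum b = (∃[ x ] P x × f x ≈ b) × (∀ x → P x → f x ≤ b)

------------------------------------------------------------------------
-- Simple digraphs of order n, with vertex set Fin n

record Digraph (n : ℕ) : Set where
  field
    edge   : Fin n → Fin n → Bool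
    noLoop : ∀ i → edge i i ≡ false

open Digraph public

outNbrs inNbrs : Digraph n → Fin n → Subset n
outNbrs Γ i = tabulate (λ j → edge Γ i j)
inNbrs  Γ i = tabulate (λ j → edge Γ j i)

d⁺ d⁻ : Digraph n → Fin n → ℕ
d⁺ Γ i = ∣ outNbrs Γ i ∣
d⁻ Γ i = ∣ inNbrs Γ i ∣

adjacency degreeMatrix laplacian : Digraph n → Matrix n
adjacency    Γ i j = if edge Γ i j then 1ℝ else 0ℝ
degreeMatrix Γ i j = if does (i ≟ j) then fromℕ (d⁺ Γ i) else 0ℝ
laplacian    Γ i j = degreeMatrix Γ i j - adjacency Γ i j

------------------------------------------------------------------------
-- Laplacian spread

Admissible : Vector ℝ n → Set
Admissible x = x ⊥ 𝐞 × ‖ x ‖≈ 1ℝ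

quadraticForm : Digraph n → Vector ℝ n → ℝ
quadraticForm Γ x = x · (laplacian Γ *ᵥ x)

-- α(Γ), β(Γ) and sp(Γ) are given by their graphs: Isα Γ a means
-- α(Γ) = a, and so on.
Isα Isβ : Digraph n → ℝ → Set
Isα Γ = IsMinimum Admissible (quadraticForm Γ)
Isβ Γ = IsMaximum Admissible (quadraticForm Γ)

IsSpread : Digraph n → ℝ → Set
IsSpread Γ s = ∃₂ λ a b → Isα Γ a × Isβ Γ b × s ≈ b - a

------------------------------------------------------------------------
-- Families of digraphs

infix 4 _≅_

_≅_ : Digraph m → Digraph n → Set
_≅_ {m} {n} Γ Δ = Σ (Fin m ↔ Fin n) λ f →
  ∀ i j → edge Γ i j ≡ edge Δ (Inverse.to f i) (Inverse.to f j)

completeDigraph : ∀ n → Digraph n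
completeDigraph n = record
  { edge   = λ i j → not (does (i ≟ j))
  ; noLoop = noLoop′
  }
  where
  noLoop′ : ∀ i → not (does (i ≟ i)) ≡ false
  noLoop′ i with i ≟ i
  ... | yes _   = refl
  ... | no  i≢i = contradiction refl i≢i

emptyDigraph : ∀ n → Digraph n
emptyDigraph n = record { edge = λ _ _ → false ; noLoop = λ _ → refl }

-- splitAt m identifies the vertex set Fin (m + k) with Fin m ⊎ Fin k.
directedJoin : Digraph m → Digraph k → Digraph (m ℕ.+ k)
directedJoin {m} {k} Γ Δ = record
  { edge   = λ i j → joinEdge (splitAt m i) (splitAt m j)
  ; noLoop = λ i → noLoop′ (splitAt m i)
  }
  where
  joinEdge : Fin m ⊎ Fin k → Fin m ⊎ Fin k → Bool
  joinEdge (inj₁ i) (inj₁ j) = edge Γ i j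
  joinEdge (inj₁ i) (inj₂ j) = true
  joinEdge (inj₂ i) (inj₁ j) = false
  joinEdge (inj₂ i) (inj₂ j) = edge Δ i j

  noLoop′ : ∀ v → joinEdge v v ≡ false
  noLoop′ (inj₁ i) = noLoop Γ i
  noLoop′ (inj₂ i) = noLoop Δ i

-- For k ≤ n the order n ∸ k + k equals n.
implodingStar : ∀ n k → Digraph (n ℕ.∸ k ℕ.+ k)
implodingStar n k = directedJoin (emptyDigraph (n ℕ.∸ k)) (completeDigraph k)

IsImplodingStar : Digraph n → Set
IsImplodingStar {n} Γ = ∃[ k ] k ℕ.≤ n × Γ ≅ implodingStar n k

IsTournament : Digraph n → Set
IsTournament Γ = ∀ i j → i ≢ j → edge Γ i j ≡ not (edge Γ j i)

IsRegularTournament : Digraph n → Set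
IsRegularTournament {n} Γ =
  3 ℕ.≤ n × n % 2 ≡ 1 × IsTournament Γ ×
  (∀ i → d⁻ Γ i ≡ (n ℕ.∸ 1) / 2 × d⁺ Γ i ≡ (n ℕ.∸ 1) / 2)

{-# OPTIONS --safe #-}

-- On the hyperplane Σ xᵢ = 0 a quadratic form is determined by its values at
-- the vectors eᵢ - eⱼ: with gᵢⱼ = M(eᵢ - eⱼ) one has -2 xᵀMx = Σᵢⱼ gᵢⱼ xᵢ xⱼ.
-- For the Laplacian, gᵢⱼ is the integer d⁺(i) + d⁺(j) + aᵢⱼ + aⱼᵢ, so the spread
-- vanishes iff this weight is the same for all pairs i ≠ j.  If moreover all
-- out-degrees agree, then aᵢⱼ + aⱼᵢ is constant, and Γ is empty, complete or a
-- regular tournament.  Otherwise comparing the weights of ik and jk shows that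
-- exactly two out-degrees d and d + 1 occur; counting out-neighbours, the
-- vertices of out-degree d number d + 1, and the others dominate precisely them.

module Submission where

open import Defs
open import Data.Nat.Base using (ℕ) renaming (_≤_ to _≤ℕ_)
open import Data.Sum.Base using (_⊎_)
open import Function.Bundles using (_⇔_)

open import Algebra.Bundles using (CommutativeRing)
import Algebra.Properties.CommutativeMonoid.Sum as CommutativeMonoidSum
import Algebra.Properties.Semiring.Sum as SemiringSum
open import Algebra.Structures {A = ℝ} _≈_ using (IsCommutativeRing)
open import Data.Bool.Base using (Bool; true; false; not; _∧_; if_then_else_)
open import Data.Fin.Base using (Fin; zero; suc; punchIn; splitAt)
open import Data.Fin.Properties
  using (_≟_; all?; ¬∀⟶∃¬; +↔⊎; splitAt⁻¹-↑ʳ; splitAt-join; punchInᵢ≢i)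
open import Data.Fin.Subset using (∣_∣)
open import Data.Integer.Base as ℤ using (+_)
import Data.Integer.Properties as ℤₚ
open import Data.Nat.Base as ℕ using (zero; suc)
open import Data.Nat.DivMod using (_/_; _%_; m*n/n≡m; [m+kn]%n≡m%n)
import Data.Nat.Properties as ℕₚ
import Data.Nat.Solver as ℕ-Solver
open import Data.Product.Base using (Σ; _×_; _,_; ∃; ∃-syntax; ∃₂; proj₁; proj₂)
open import Data.Rational.Base as ℚ using (ℚ; 0ℚ; 1ℚ; ½)
import Data.Rational.Properties as ℚₚ
import Data.Rational.Solver as ℚ-Solver
import Data.Rational.Unnormalised.Base as ℚᵘ
import Data.Rational.Unnormalised.Properties as ℚᵘₚ
open import Data.Sum.Base using (inj₁; inj₂; map; map₁; map₂)
open import Data.Vec.Base using (tabulate)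
open import Data.Vec.Functional using (Vector; removeAt)
open import Function.Base using (_∘_; id)
open import Function.Bundles using (_↔_; mk↔ₛ′; mk⇔; Injection; Inverse)
open import Function.Construct.Composition using (_↔-∘_)
open import Function.Construct.Symmetry using (↔-sym)
open import Function.Properties.Inverse using (↔⇒↣)
open import Relation.Binary.Definitions using (tri<; tri≈; tri>)
open import Relation.Binary.PropositionalEquality
  using (_≡_; _≢_; refl; sym; trans; cong; cong₂; subst; subst₂; module ≡-Reasoning)
import Relation.Binary.Reasoning.Setoid as SetoidReasoning
open import Relation.Nullary.Decidable
  using (does; proof; yes; no; dec-true; dec-false; toWitness)
open import Relation.Nullary.Negation using (contradiction)
open import Relation.Nullary.Reflects using (Reflects; invert)

open ℚ-Solver.+-*-Solver
private
  module ℕ-Ring = ℕ-Solver.+-*-Solver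
  module ∑ℕ = CommutativeMonoidSum ℕₚ.+-0-commutativeMonoid

  variable
    n : ℕ

-- Reals are Cauchy sequences whose equality cannot be decided, so the case distinctions of the
-- classification have to be made over ℕ. The passage is made by the admissible vectors (eᵢ -
-- eⱼ)/√2: there the form is half an integer weight, and `fromℕ-injective` turns equality of real
-- values into equality of natural numbers. The price is one irrational number: norm exactly 1 calls
-- for √½, which is built as a Cauchy sequence with an explicit error bound. In the other direction
-- a form that is constant on the admissible vectors attains both extremes at any one of them.
--
-- In the case of unequal out-degrees the pivot is the number of arcs between a vertex of smaller
-- and one of larger out-degree. It must be 1: with 0 the larger out-degree would be 0, and with 2
-- it would be n. Once it is known, so is the constant weight, and with it the number of arcs
-- between any two vertices.

half-half : ∀ ε → ε ℚ.* ½ ℚ.+ ε ℚ.* ½ ≡ ε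
half-half ε = trans (sym (ℚₚ.*-distribˡ-+ ε ½ ½)) (ℚₚ.*-identityʳ ε)

half-pos : ∀ {ε} → 0ℚ ℚ.< ε → 0ℚ ℚ.< ε ℚ.* ½
half-pos {ε} 0<ε =
  subst (ℚ._< ε ℚ.* ½) (ℚₚ.*-zeroˡ ½) (ℚₚ.*-monoˡ-<-pos ½ 0<ε)

p≤∣p∣ : ∀ p → p ℚ.≤ ℚ.∣ p ∣
p≤∣p∣ p with ℚₚ.≤-total 0ℚ p
... | inj₁ 0≤p = ℚₚ.≤-reflexive (sym (ℚₚ.0≤p⇒∣p∣≡p 0≤p))
... | inj₂ p≤0 = ℚₚ.≤-trans p≤0 (ℚₚ.0≤∣p∣ p)

∣p∣<q : ∀ {p q} → p ℚ.< q → ℚ.- p ℚ.< q → ℚ.∣ p ∣ ℚ.< q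
∣p∣<q {p} {q} p<q -p<q with ℚₚ.∣p∣≡p∨∣p∣≡-p p
... | inj₁ eq = subst (ℚ._< q) (sym eq) p<q
... | inj₂ eq = subst (ℚ._< q) (sym eq) -p<q

∣p∣≤q : ∀ {p q} → p ℚ.≤ q → ℚ.- p ℚ.≤ q → ℚ.∣ p ∣ ℚ.≤ q
∣p∣≤q {p} {q} p≤q -p≤q with ℚₚ.∣p∣≡p∨∣p∣≡-p p
... | inj₁ eq = subst (ℚ._≤ q) (sym eq) p≤q
... | inj₂ eq = subst (ℚ._≤ q) (sym eq) -p≤q

*-mono-≤-nonNeg : ∀ {a b c d} → 0ℚ ℚ.≤ a → 0ℚ ℚ.≤ d →
                  a ℚ.≤ b → c ℚ.≤ d → a ℚ.* c ℚ.≤ b ℚ.* d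
*-mono-≤-nonNeg {a} {b} {c} {d} 0≤a 0≤d a≤b c≤d = ℚₚ.≤-trans
  (ℚₚ.*-monoˡ-≤-nonNeg a {{ℚ.nonNegative 0≤a}} c≤d)
  (ℚₚ.*-monoʳ-≤-nonNeg d {{ℚ.nonNegative 0≤d}} a≤b)

-- Null sequences

Null : (ℕ → ℚ) → Set
Null s = ∀ ε → 0ℚ ℚ.< ε → ∃[ N ] ∀ i → N ℕ.≤ i → ℚ.∣ s i ∣ ℚ.< ε

null-cong : ∀ {s t} → (∀ i → s i ≡ t i) → Null s → Null t
null-cong s≡t s-null ε 0<ε with s-null ε 0<ε
... | N , f = N , λ i N≤i → subst (λ z → ℚ.∣ z ∣ ℚ.< ε) (s≡t i) (f i N≤i)

null-0 : Null (λ _ → 0ℚ)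
null-0 ε 0<ε = 0 , λ _ _ → 0<ε

null-+ : ∀ {s t} → Null s → Null t → Null (λ i → s i ℚ.+ t i)
null-+ {s} {t} s-null t-null ε 0<ε
  with s-null (ε ℚ.* ½) (half-pos 0<ε) | t-null (ε ℚ.* ½) (half-pos 0<ε)
... | M , f | N , g = M ℕ.⊔ N , λ i p → begin-strict
    ℚ.∣ s i ℚ.+ t i ∣          ≤⟨ ℚₚ.∣p+q∣≤∣p∣+∣q∣ (s i) (t i) ⟩
    ℚ.∣ s i ∣ ℚ.+ ℚ.∣ t i ∣    <⟨ ℚₚ.+-mono-< (f i (ℕₚ.m⊔n≤o⇒m≤o M N p))
                                              (g i (ℕₚ.m⊔n≤o⇒n≤o M N p)) ⟩
    ε ℚ.* ½ ℚ.+ ε ℚ.* ½       ≡⟨ half-half ε ⟩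
    ε                          ∎
  where open ℚₚ.≤-Reasoning

null-neg : ∀ {s} → Null s → Null (λ i → ℚ.- s i)
null-neg {s} s-null ε 0<ε with s-null ε 0<ε
... | N , f = N , λ i p → subst (ℚ._< ε) (sym (ℚₚ.∣-p∣≡∣p∣ (s i))) (f i p)

cauchy⇒bounded : ∀ {s} → IsCauchy s →
  ∃₂ λ B N → 0ℚ ℚ.< B × (∀ i → N ℕ.≤ i → ℚ.∣ s i ∣ ℚ.≤ B)
cauchy⇒bounded {s} cs with cs 1ℚ (ℚₚ.positive⁻¹ 1ℚ)
... | N , f = 1ℚ ℚ.+ ℚ.∣ s N ∣ , N ,
    ℚₚ.+-mono-<-≤ (ℚₚ.positive⁻¹ 1ℚ) (ℚₚ.0≤∣p∣ (s N)) , λ i p → begin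
    ℚ.∣ s i ∣
      ≡⟨ cong ℚ.∣_∣ (solve 2 (λ a b → a := (a :- b) :+ b) refl (s i) (s N)) ⟩
    ℚ.∣ (s i ℚ.- s N) ℚ.+ s N ∣
      ≤⟨ ℚₚ.∣p+q∣≤∣p∣+∣q∣ (s i ℚ.- s N) (s N) ⟩
    ℚ.∣ s i ℚ.- s N ∣ ℚ.+ ℚ.∣ s N ∣
      <⟨ ℚₚ.+-monoˡ-< ℚ.∣ s N ∣ (f i N p ℕₚ.≤-refl) ⟩
    1ℚ ℚ.+ ℚ.∣ s N ∣ ∎
  where open ℚₚ.≤-Reasoning

quotient : ∀ {ε C} → 0ℚ ℚ.< ε → 0ℚ ℚ.< C → ∃[ δ ] 0ℚ ℚ.< δ × C ℚ.* δ ≡ ε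
quotient {ε} {C} 0<ε 0<C = C⁻¹ ℚ.* ε , 0<δ , eq
  where
  instance
    C-pos : ℚ.Positive C
    C-pos = ℚ.positive 0<C
    C≢0 : ℚ.NonZero C
    C≢0 = ℚₚ.pos⇒nonZero C
  C⁻¹ : ℚ
  C⁻¹ = ℚ.1/ C
  0<δ : 0ℚ ℚ.< C⁻¹ ℚ.* ε
  0<δ = subst (ℚ._< C⁻¹ ℚ.* ε) (ℚₚ.*-zeroʳ C⁻¹)
    (ℚₚ.*-monoʳ-<-pos C⁻¹ {{ℚₚ.1/pos⇒pos C}} 0<ε)
  eq : C ℚ.* (C⁻¹ ℚ.* ε) ≡ ε
  eq = trans (sym (ℚₚ.*-assoc C C⁻¹ ε))
    (trans (cong (ℚ._* ε) (ℚₚ.*-inverseʳ C)) (ℚₚ.*-identityˡ ε))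

null-* : ∀ {s t} → IsCauchy s → Null t → Null (λ i → s i ℚ.* t i)
null-* {s} {t} cs t-null ε 0<ε =
  let B , M , 0<B , s≤B = cauchy⇒bounded {s} cs
      δ , 0<δ , B*δ≡ε   = quotient {ε} {B} 0<ε 0<B
      N , f             = t-null δ 0<δ
  in M ℕ.⊔ N , λ i p → begin-strict
    ℚ.∣ s i ℚ.* t i ∣          ≡⟨ ℚₚ.∣p*q∣≡∣p∣*∣q∣ (s i) (t i) ⟩
    ℚ.∣ s i ∣ ℚ.* ℚ.∣ t i ∣    ≤⟨ ℚₚ.*-monoʳ-≤-nonNeg ℚ.∣ t i ∣ {{ℚₚ.∣-∣-nonNeg (t i)}}
                                   (s≤B i (ℕₚ.m⊔n≤o⇒m≤o M N p)) ⟩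
    B ℚ.* ℚ.∣ t i ∣            <⟨ ℚₚ.*-monoʳ-<-pos B {{ℚ.positive 0<B}}
                                   (f i (ℕₚ.m⊔n≤o⇒n≤o M N p)) ⟩
    B ℚ.* δ                    ≡⟨ B*δ≡ε ⟩
    ε                          ∎
  where open ℚₚ.≤-Reasoning

-- The commutative ring of reals

seq≡⇒≈ : ∀ {x y} → (∀ i → seq x i ≡ seq y i) → x ≈ y
seq≡⇒≈ {x} {y} eq = mk≈ (null-cong
  (λ i → sym (trans (cong (ℚ._- seq y i) (eq i)) (ℚₚ.+-inverseʳ (seq y i)))) null-0)

≈-refl : ∀ {x} → x ≈ x
≈-refl = seq≡⇒≈ λ _ → refl

≈-sym : ∀ {x y} → x ≈ y → y ≈ x
≈-sym {x} {y} (mk≈ p) = mk≈ (null-cong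
  (λ i → solve 2 (λ a b → :- (a :- b) := b :- a) refl (seq x i) (seq y i))
  (null-neg p))

≈-trans : ∀ {x y z} → x ≈ y → y ≈ z → x ≈ z
≈-trans {x} {y} {z} (mk≈ p) (mk≈ q) = mk≈ (null-cong
  (λ i → solve 3 (λ a b c → (a :- b) :+ (b :- c) := a :- c)
    refl (seq x i) (seq y i) (seq z i))
  (null-+ p q))

+-cong : ∀ {x y u v} → x ≈ y → u ≈ v → x + u ≈ y + v
+-cong {x} {y} {u} {v} (mk≈ p) (mk≈ q) = mk≈ (null-cong
  (λ i → solve 4 (λ a b c d → (a :- b) :+ (c :- d) := (a :+ c) :- (b :+ d))
    refl (seq x i) (seq y i) (seq u i) (seq v i))
  (null-+ p q))

-‿cong : ∀ {x y} → x ≈ y → - x ≈ - y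
-‿cong {x} {y} (mk≈ p) = mk≈ (null-cong
  (λ i → solve 2 (λ a b → :- (a :- b) := :- a :- :- b) refl (seq x i) (seq y i))
  (null-neg p))

*-cong : ∀ {x y u v} → x ≈ y → u ≈ v → x * u ≈ y * v
*-cong {x} {y} {u} {v} (mk≈ p) (mk≈ q) = mk≈ (null-cong
  (λ i → solve 4 (λ a b c d → a :* (c :- d) :+ d :* (a :- b) := a :* c :- b :* d)
    refl (seq x i) (seq y i) (seq u i) (seq v i))
  (null-+ {λ i → seq x i ℚ.* (seq u i ℚ.- seq v i)} {λ i → seq v i ℚ.* (seq x i ℚ.- seq y i)}
    (null-* {seq x} {λ i → seq u i ℚ.- seq v i} (cauchy x) q)
    (null-* {seq v} {λ i → seq x i ℚ.- seq y i} (cauchy v) p)))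

ℝ-isCommutativeRing : IsCommutativeRing _+_ _*_ -_ 0ℝ 1ℝ
ℝ-isCommutativeRing = record
  { isRing = record
    { +-isAbelianGroup = record
      { isGroup = record
        { isMonoid = record
          { isSemigroup = record
            { isMagma = record
              { isEquivalence = record
                { refl = ≈-refl ; sym = ≈-sym ; trans = ≈-trans }
              ; ∙-cong = +-cong
              }
            ; assoc = λ x y z → seq≡⇒≈ λ i → ℚₚ.+-assoc (seq x i) (seq y i) (seq z i)
            }
          ; identity = (λ x → seq≡⇒≈ λ i → ℚₚ.+-identityˡ (seq x i))
                     , (λ x → seq≡⇒≈ λ i → ℚₚ.+-identityʳ (seq x i))
          }
        ; inverse = (λ x → seq≡⇒≈ λ i → ℚₚ.+-inverseˡ (seq x i))
                  , (λ x → seq≡⇒≈ λ i → ℚₚ.+-inverseʳ (seq x i))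
        ; ⁻¹-cong = -‿cong
        }
      ; comm = λ x y → seq≡⇒≈ λ i → ℚₚ.+-comm (seq x i) (seq y i)
      }
    ; *-cong = *-cong
    ; *-assoc = λ x y z → seq≡⇒≈ λ i → ℚₚ.*-assoc (seq x i) (seq y i) (seq z i)
    ; *-identity = (λ x → seq≡⇒≈ λ i → ℚₚ.*-identityˡ (seq x i))
                 , (λ x → seq≡⇒≈ λ i → ℚₚ.*-identityʳ (seq x i))
    ; distrib =
        (λ x y z → seq≡⇒≈ λ i → ℚₚ.*-distribˡ-+ (seq x i) (seq y i) (seq z i))
      , (λ x y z → seq≡⇒≈ λ i → ℚₚ.*-distribʳ-+ (seq x i) (seq y i) (seq z i))
    }
  ; *-comm = λ x y → seq≡⇒≈ λ i → ℚₚ.*-comm (seq x i) (seq y i)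
  }

ℝ-commutativeRing : CommutativeRing _ _
ℝ-commutativeRing = record { isCommutativeRing = ℝ-isCommutativeRing }

-- Order

≈⇒≤ : ∀ {x y} → x ≈ y → x ≤ y
≈⇒≤ {x} {y} (mk≈ p) = mk≤ λ ε 0<ε → let N , f = p ε 0<ε in
  N , λ i q → ℚₚ.≤-<-trans (p≤∣p∣ (seq x i ℚ.- seq y i)) (f i q)

≤-trans : ∀ {x y z} → x ≤ y → y ≤ z → x ≤ z
≤-trans {x} {y} {z} (mk≤ p) (mk≤ q) = mk≤ λ ε 0<ε →
  let M , f = p (ε ℚ.* ½) (half-pos 0<ε)
      N , g = q (ε ℚ.* ½) (half-pos 0<ε)
  in M ℕ.⊔ N , λ i r → subst₂ ℚ._<_
       (solve 3 (λ a b c → (a :- b) :+ (b :- c) := a :- c)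
         refl (seq x i) (seq y i) (seq z i))
       (half-half ε)
       (ℚₚ.+-mono-< (f i (ℕₚ.m⊔n≤o⇒m≤o M N r)) (g i (ℕₚ.m⊔n≤o⇒n≤o M N r)))

≤-antisym : ∀ {x y} → x ≤ y → y ≤ x → x ≈ y
≤-antisym {x} {y} (mk≤ p) (mk≤ q) = mk≈ λ ε 0<ε →
  let M , f = p ε 0<ε
      N , g = q ε 0<ε
  in M ℕ.⊔ N , λ i r → ∣p∣<q (f i (ℕₚ.m⊔n≤o⇒m≤o M N r))
       (subst (ℚ._< ε)
         (solve 2 (λ a b → b :- a := :- (a :- b)) refl (seq x i) (seq y i))
         (g i (ℕₚ.m⊔n≤o⇒n≤o M N r)))

fromℚ-mono : ∀ {p q} → p ℚ.≤ q → fromℚ p ≤ fromℚ q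
fromℚ-mono {p} {q} p≤q = mk≤ λ ε 0<ε → 0 , λ _ _ → ℚₚ.≤-<-trans
  (subst (p ℚ.- q ℚ.≤_) (ℚₚ.+-inverseʳ q) (ℚₚ.+-monoˡ-≤ (ℚ.- q) p≤q)) 0<ε

-- If |p - q| were positive it could serve as ε itself, and closeness of the constant sequences
-- would give |p - q| < |p - q|.
fromℚ-injective : ∀ {p q} → fromℚ p ≈ fromℚ q → p ≡ q
fromℚ-injective {p} {q} (mk≈ p≈q) =
  x∙y⁻¹≈ε⇒x≈y p q (ℚₚ.∣p∣≡0⇒p≡0 (p ℚ.- q) (ℚₚ.≤-antisym
    (ℚₚ.≮⇒≥ λ 0<∣p-q∣ → let N , f = p≈q ℚ.∣ p ℚ.- q ∣ 0<∣p-q∣ in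
      ℚₚ.<-irrefl refl (f N ℕₚ.≤-refl))
    (ℚₚ.0≤∣p∣ (p ℚ.- q))))
  where open import Algebra.Properties.Group ℚₚ.+-0-group using (x∙y⁻¹≈ε⇒x≈y)

-- Natural numbers inside ℚ

ℕ→ℚ : ℕ → ℚ
ℕ→ℚ n = + n ℚ./ 1

toℚᵘ-ℕ→ℚ : ∀ n → ℚ.toℚᵘ (ℕ→ℚ n) ℚᵘ.≃ ℚᵘ.mkℚᵘ (+ n) 0
toℚᵘ-ℕ→ℚ n = ℚₚ.toℚᵘ-fromℚᵘ (ℚᵘ.mkℚᵘ (+ n) 0)

ℕ→ℚ-homo-+ : ∀ m n → ℕ→ℚ (m ℕ.+ n) ≡ ℕ→ℚ m ℚ.+ ℕ→ℚ n
ℕ→ℚ-homo-+ m n = ℚₚ.toℚᵘ-injective (begin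
  ℚ.toℚᵘ (ℕ→ℚ (m ℕ.+ n))                     ≈⟨ toℚᵘ-ℕ→ℚ (m ℕ.+ n) ⟩
  ℚᵘ.mkℚᵘ (+ (m ℕ.+ n)) 0                    ≈⟨ ℚᵘ.*≡* (cong (ℤ._* (+ 1))
      (sym (cong₂ ℤ._+_ (ℤₚ.*-identityʳ (+ m)) (ℤₚ.*-identityʳ (+ n))))) ⟩
  ℚᵘ.mkℚᵘ (+ m) 0 ℚᵘ.+ ℚᵘ.mkℚᵘ (+ n) 0       ≈⟨ ℚᵘₚ.+-cong (toℚᵘ-ℕ→ℚ m) (toℚᵘ-ℕ→ℚ n) ⟨
  ℚ.toℚᵘ (ℕ→ℚ m) ℚᵘ.+ ℚ.toℚᵘ (ℕ→ℚ n)         ≈⟨ ℚₚ.toℚᵘ-homo-+ (ℕ→ℚ m) (ℕ→ℚ n) ⟨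
  ℚ.toℚᵘ (ℕ→ℚ m ℚ.+ ℕ→ℚ n)                   ∎)
  where open ℚᵘₚ.≃-Reasoning

ℕ→ℚ-injective : ∀ {m n} → ℕ→ℚ m ≡ ℕ→ℚ n → m ≡ n
ℕ→ℚ-injective {m} {n} eq
  with ℚₚ./-injective-≃ (ℚᵘ.mkℚᵘ (+ m) 0) (ℚᵘ.mkℚᵘ (+ n) 0) eq
... | ℚᵘ.*≡* p = ℤₚ.+-injective
  (trans (sym (ℤₚ.*-identityʳ (+ m))) (trans p (ℤₚ.*-identityʳ (+ n))))

fromℕ-injective : ∀ {m n} → fromℕ m ≈ fromℕ n → m ≡ n
fromℕ-injective {m} {n} p = ℕ→ℚ-injective (fromℚ-injective {ℕ→ℚ m} {ℕ→ℚ n} p)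

ℕ→ℚ-mono-≤ : ∀ {m n} → m ℕ.≤ n → ℕ→ℚ m ℚ.≤ ℕ→ℚ n
ℕ→ℚ-mono-≤ {m} {n} m≤n = ℚₚ.toℚᵘ-cancel-≤ (begin
  ℚ.toℚᵘ (ℕ→ℚ m)     ≃⟨ toℚᵘ-ℕ→ℚ m ⟩
  ℚᵘ.mkℚᵘ (+ m) 0    ≤⟨ ℚᵘ.*≤* (ℤₚ.*-monoʳ-≤-nonNeg (+ 1) (ℤ.+≤+ m≤n)) ⟩
  ℚᵘ.mkℚᵘ (+ n) 0    ≃⟨ toℚᵘ-ℕ→ℚ n ⟨
  ℚ.toℚᵘ (ℕ→ℚ n)     ∎)
  where open ℚᵘₚ.≤-Reasoning

-- The witness is the denominator of ε, which `mkℚ` stores decreased by one: ε times it is the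
-- numerator, a positive integer.
archimedean : ∀ {ε} → 0ℚ ℚ.< ε → ∃[ N ] 1ℚ ℚ.≤ ε ℚ.* ℕ→ℚ N
archimedean {ε@(ℚ.mkℚ (+ suc k) d _)} _ = suc d , ℚₚ.toℚᵘ-cancel-≤ (begin
  ℚ.toℚᵘ 1ℚ                              ≤⟨ ℚᵘ.*≤* (ℤ.+≤+ (ℕₚ.≤-trans
      (ℕₚ.≤-reflexive (trans (ℕₚ.*-identityˡ _) (ℕₚ.*-identityʳ _)))
      (ℕₚ.≤-trans (ℕₚ.m≤m+n (suc d) _) (ℕₚ.≤-reflexive (sym (ℕₚ.*-identityʳ _)))))) ⟩
  ℚ.toℚᵘ ε ℚᵘ.* ℚᵘ.mkℚᵘ (+ suc d) 0      ≃⟨ ℚᵘₚ.*-congˡ (toℚᵘ-ℕ→ℚ (suc d)) ⟨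
  ℚ.toℚᵘ ε ℚᵘ.* ℚ.toℚᵘ (ℕ→ℚ (suc d))    ≃⟨ ℚₚ.toℚᵘ-homo-* ε (ℕ→ℚ (suc d)) ⟨
  ℚ.toℚᵘ (ε ℚ.* ℕ→ℚ (suc d))            ∎)
  where open ℚᵘₚ.≤-Reasoning
archimedean {ℚ.mkℚ (+ zero) _ _} (ℚ.*<* (ℤ.+<+ ()))
archimedean {ℚ.mkℚ (ℤ.-[1+ _ ]) _ _} (ℚ.*<* ())

-- The square root of ½

-- A polynomial iteration with fixed point √½, so that no division is needed.
√½-seq : ℕ → ℚ
√½-seq zero    = ½
√½-seq (suc i) = ½ ℚ.+ √½-seq i ℚ.* (1ℚ ℚ.- √½-seq i)

-- The interval [½, 1] is invariant because s (1 - s) lies between 0 and ½ on it. Both ends matter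
-- later: 0 ≤ 1 - s ≤ ½ makes the error shrink, and s ≥ ½ keeps the sum of two terms at least 1.
√½-seq-bounds : ∀ i → ½ ℚ.≤ √½-seq i × √½-seq i ℚ.≤ 1ℚ
√½-seq-bounds zero = ℚₚ.≤-refl , toWitness {a? = ½ ℚₚ.≤? 1ℚ} _
√½-seq-bounds (suc i) with √½-seq i | √½-seq-bounds i
... | s | ½≤s , s≤1 =
    subst (ℚ._≤ ½ ℚ.+ s ℚ.* (1ℚ ℚ.- s)) (ℚₚ.+-identityʳ ½)
      (ℚₚ.+-monoʳ-≤ ½ (subst (ℚ._≤ s ℚ.* (1ℚ ℚ.- s)) (ℚₚ.*-zeroʳ s)
        (ℚₚ.*-monoˡ-≤-nonNeg s {{ℚ.nonNegative 0≤s}} 0≤1-s)))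
  , ℚₚ.+-monoʳ-≤ ½ (*-mono-≤-nonNeg {b = 1ℚ} {d = ½} 0≤s 0≤½ s≤1
      (ℚₚ.+-monoʳ-≤ 1ℚ (ℚₚ.neg-antimono-≤ ½≤s)))
  where
  0≤½ : 0ℚ ℚ.≤ ½
  0≤½ = toWitness {a? = 0ℚ ℚₚ.≤? ½} _
  0≤s : 0ℚ ℚ.≤ s
  0≤s = ℚₚ.≤-trans 0≤½ ½≤s
  0≤1-s : 0ℚ ℚ.≤ 1ℚ ℚ.- s
  0≤1-s = ℚₚ.+-monoʳ-≤ 1ℚ (ℚₚ.neg-antimono-≤ s≤1)

√½-error : ℕ → ℚ
√½-error i = √½-seq i ℚ.* √½-seq i ℚ.- ½

-- With e = s² - ½ the iteration reads s - e, and (s - e)² - ½ = e (1 - 2s + e), where the second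
-- factor is (1 - s)² - ½.
√½-error-suc : ∀ i → √½-error (suc i) ≡
  √½-error i ℚ.* ((1ℚ ℚ.- √½-seq i) ℚ.* (1ℚ ℚ.- √½-seq i) ℚ.- ½)
√½-error-suc i = solve 1 (λ s →
  (con ½ :+ s :* (con 1ℚ :- s)) :* (con ½ :+ s :* (con 1ℚ :- s)) :- con ½ :=
  (s :* s :- con ½) :* ((con 1ℚ :- s) :* (con 1ℚ :- s) :- con ½)) refl (√½-seq i)

-- As 0 ≤ 1 - s ≤ ½, the factor (1 - s)² - ½ lies between -½ and 0.
√½-error-halves : ∀ i → ℚ.∣ √½-error (suc i) ∣ ℚ.≤ ℚ.∣ √½-error i ∣ ℚ.* ½
√½-error-halves i = begin
  ℚ.∣ √½-error (suc i) ∣           ≡⟨ cong ℚ.∣_∣ (√½-error-suc i) ⟩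
  ℚ.∣ √½-error i ℚ.* c ∣           ≡⟨ ℚₚ.∣p*q∣≡∣p∣*∣q∣ (√½-error i) c ⟩
  ℚ.∣ √½-error i ∣ ℚ.* ℚ.∣ c ∣     ≤⟨ ℚₚ.*-monoˡ-≤-nonNeg ℚ.∣ √½-error i ∣
                                      {{ℚₚ.∣-∣-nonNeg (√½-error i)}} ∣c∣≤½ ⟩
  ℚ.∣ √½-error i ∣ ℚ.* ½           ∎
  where
  open ℚₚ.≤-Reasoning
  u c : ℚ
  u = 1ℚ ℚ.- √½-seq i
  c = u ℚ.* u ℚ.- ½
  0≤½ : 0ℚ ℚ.≤ ½
  0≤½ = toWitness {a? = 0ℚ ℚₚ.≤? ½} _
  0≤u : 0ℚ ℚ.≤ u
  0≤u = ℚₚ.+-monoʳ-≤ 1ℚ (ℚₚ.neg-antimono-≤ (proj₂ (√½-seq-bounds i)))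
  u≤½ : u ℚ.≤ ½
  u≤½ = ℚₚ.+-monoʳ-≤ 1ℚ (ℚₚ.neg-antimono-≤ (proj₁ (√½-seq-bounds i)))
  0≤u² : 0ℚ ℚ.≤ u ℚ.* u
  0≤u² = subst (ℚ._≤ u ℚ.* u) (ℚₚ.*-zeroʳ u)
    (ℚₚ.*-monoˡ-≤-nonNeg u {{ℚ.nonNegative 0≤u}} 0≤u)
  u²≤½ : u ℚ.* u ℚ.≤ ½
  u²≤½ = ℚₚ.≤-trans (*-mono-≤-nonNeg 0≤u 0≤½ u≤½ u≤½) (toWitness {a? = ½ ℚ.* ½ ℚₚ.≤? ½} _)
  ∣c∣≤½ : ℚ.∣ c ∣ ℚ.≤ ½
  ∣c∣≤½ = ∣p∣≤q
    (ℚₚ.≤-trans (ℚₚ.+-monoˡ-≤ (ℚ.- ½) u²≤½) 0≤½)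
    (subst (ℚ._≤ ½) (solve 1 (λ x → con ½ :- x := :- (x :- con ½)) refl (u ℚ.* u))
      (ℚₚ.+-monoʳ-≤ ½ (ℚₚ.neg-antimono-≤ 0≤u²)))

-- The geometric decay is weakened to 1/(i + 1), a rate that `archimedean` can be compared with
-- directly. The induction works because ½ (i + 2) ≤ i + 1.
√½-error-bound : ∀ i → ℚ.∣ √½-error i ∣ ℚ.* ℕ→ℚ (suc i) ℚ.≤ 1ℚ
√½-error-bound zero = toWitness {a? = ℚ.∣ √½-error 0 ∣ ℚ.* ℕ→ℚ 1 ℚₚ.≤? 1ℚ} _
√½-error-bound (suc i) = begin
  ℚ.∣ √½-error (suc i) ∣ ℚ.* k+1
    ≤⟨ ℚₚ.*-monoʳ-≤-nonNeg k+1 {{ℚ.nonNegative 0≤k+1}} (√½-error-halves i) ⟩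
  (e ℚ.* ½) ℚ.* k+1
    ≡⟨ ℚₚ.*-assoc e ½ k+1 ⟩
  e ℚ.* (½ ℚ.* k+1)
    ≤⟨ ℚₚ.*-monoˡ-≤-nonNeg e {{ℚₚ.∣-∣-nonNeg (√½-error i)}} half≤ ⟩
  e ℚ.* k
    ≤⟨ √½-error-bound i ⟩
  1ℚ ∎
  where
  open ℚₚ.≤-Reasoning
  e k k+1 : ℚ
  e = ℚ.∣ √½-error i ∣
  k = ℕ→ℚ (suc i)
  k+1 = ℕ→ℚ (suc (suc i))
  0≤k+1 : 0ℚ ℚ.≤ k+1
  0≤k+1 = ℕ→ℚ-mono-≤ {0} {suc (suc i)} ℕ.z≤n
  half≤ : ½ ℚ.* k+1 ℚ.≤ k
  half≤ = begin
    ½ ℚ.* k+1         ≡⟨ cong (½ ℚ.*_) (ℕ→ℚ-homo-+ 1 (suc i)) ⟩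
    ½ ℚ.* (1ℚ ℚ.+ k)  ≤⟨ ℚₚ.*-monoˡ-≤-nonNeg ½ (ℚₚ.+-monoˡ-≤ k
                           (ℕ→ℚ-mono-≤ {1} {suc i} (ℕ.s≤s ℕ.z≤n))) ⟩
    ½ ℚ.* (k ℚ.+ k)   ≡⟨ solve 1 (λ x → con ½ :* (x :+ x) := x) refl k ⟩
    k ∎

√½-error-null : Null √½-error
√½-error-null ε 0<ε with archimedean 0<ε
... | N , 1≤ε*N = N , λ i N≤i →
  let instance
        i+1-pos : ℚ.Positive (ℕ→ℚ (suc i))
        i+1-pos = ℚ.positive (ℚₚ.<-≤-trans (ℚₚ.positive⁻¹ 1ℚ)
          (ℕ→ℚ-mono-≤ {1} {suc i} (ℕ.s≤s ℕ.z≤n)))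
      N<i+1 = ℚₚ.<-≤-trans {ℕ→ℚ N} {1ℚ ℚ.+ ℕ→ℚ N}
        (subst (ℚ._< 1ℚ ℚ.+ ℕ→ℚ N) (ℚₚ.+-identityˡ (ℕ→ℚ N))
          (ℚₚ.+-monoˡ-< (ℕ→ℚ N) (ℚₚ.positive⁻¹ 1ℚ)))
        (subst (ℚ._≤ ℕ→ℚ (suc i)) (ℕ→ℚ-homo-+ 1 N) (ℕ→ℚ-mono-≤ (ℕ.s≤s N≤i)))
  in ℚₚ.*-cancelʳ-<-nonNeg (ℕ→ℚ (suc i)) {{ℚₚ.pos⇒nonNeg (ℕ→ℚ (suc i))}}
       (ℚₚ.≤-<-trans (√½-error-bound i) (ℚₚ.≤-<-trans 1≤ε*N
         (ℚₚ.*-monoʳ-<-pos ε {{ℚ.positive 0<ε}} N<i+1)))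

-- Multiplying by s + t ≥ 1 cannot shrink |s - t|. Thus errors of the squares that tend to 0 force
-- the terms themselves to be Cauchy.
∣s-t∣≤∣s²-t²∣ : ∀ {s t} → ½ ℚ.≤ s → ½ ℚ.≤ t →
  ℚ.∣ s ℚ.- t ∣ ℚ.≤ ℚ.∣ (s ℚ.* s ℚ.- ½) ℚ.- (t ℚ.* t ℚ.- ½) ∣
∣s-t∣≤∣s²-t²∣ {s} {t} ½≤s ½≤t = begin
  ℚ.∣ s ℚ.- t ∣
    ≡⟨ ℚₚ.*-identityʳ ℚ.∣ s ℚ.- t ∣ ⟨
  ℚ.∣ s ℚ.- t ∣ ℚ.* 1ℚ
    ≤⟨ ℚₚ.*-monoˡ-≤-nonNeg ℚ.∣ s ℚ.- t ∣ {{ℚₚ.∣-∣-nonNeg (s ℚ.- t)}}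
         (ℚₚ.≤-trans (ℚₚ.+-mono-≤ ½≤s ½≤t) (p≤∣p∣ (s ℚ.+ t))) ⟩
  ℚ.∣ s ℚ.- t ∣ ℚ.* ℚ.∣ s ℚ.+ t ∣
    ≡⟨ ℚₚ.∣p*q∣≡∣p∣*∣q∣ (s ℚ.- t) (s ℚ.+ t) ⟨
  ℚ.∣ (s ℚ.- t) ℚ.* (s ℚ.+ t) ∣
    ≡⟨ cong ℚ.∣_∣ (solve 2 (λ a b →
         (a :- b) :* (a :+ b) := (a :* a :- con ½) :- (b :* b :- con ½)) refl s t) ⟩
  ℚ.∣ (s ℚ.* s ℚ.- ½) ℚ.- (t ℚ.* t ℚ.- ½) ∣ ∎
  where open ℚₚ.≤-Reasoning

√½-cauchy : IsCauchy √½-seq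
√½-cauchy ε 0<ε = let N , f = √½-error-null (ε ℚ.* ½) (half-pos 0<ε) in
  N , λ i j p q → begin-strict
    ℚ.∣ √½-seq i ℚ.- √½-seq j ∣
      ≤⟨ ∣s-t∣≤∣s²-t²∣ (proj₁ (√½-seq-bounds i)) (proj₁ (√½-seq-bounds j)) ⟩
    ℚ.∣ √½-error i ℚ.- √½-error j ∣
      ≤⟨ ℚₚ.∣p-q∣≤∣p∣+∣q∣ (√½-error i) (√½-error j) ⟩
    ℚ.∣ √½-error i ∣ ℚ.+ ℚ.∣ √½-error j ∣
      <⟨ ℚₚ.+-mono-< (f i p) (f j q) ⟩
    ε ℚ.* ½ ℚ.+ ε ℚ.* ½
      ≡⟨ half-half ε ⟩
    ε ∎
  where open ℚₚ.≤-Reasoning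

½ℝ √½ : ℝ
½ℝ = fromℚ ½
√½ .seq    = √½-seq
√½ .cauchy = √½-cauchy

√½*√½≈½ : √½ * √½ ≈ ½ℝ
√½*√½≈½ = mk≈ √½-error-null

-- Linear algebra

private
  module R = CommutativeRing ℝ-commutativeRing
  module ≈-Reasoning = SetoidReasoning R.setoid

open SemiringSum R.semiring
  using (sum-cong-≋; sum-replicate-zero; ∑-distrib-+; ∑-comm; *-distribˡ-sum; *-distribʳ-sum)

∑-distrib-- : (f g : Vector ℝ n) → sum (λ i → f i - g i) ≈ sum f - sum g
∑-distrib-- {zero}  f g = seq≡⇒≈ λ _ → refl
∑-distrib-- {suc n} f g = ≈-trans
  (+-cong ≈-refl (∑-distrib-- (f ∘ suc) (g ∘ suc)))
  (seq≡⇒≈ λ k → solve 4 (λ a b c d → (a :- b) :+ (c :- d) := (a :+ c) :- (b :+ d)) refl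
    (seq (f zero) k) (seq (g zero) k) (seq (sum (f ∘ suc)) k) (seq (sum (g ∘ suc)) k))

δ : Fin n → Fin n → ℝ
δ i j = if does (i ≟ j) then 1ℝ else 0ℝ

δ-diag : (i : Fin n) → δ i i ≈ 1ℝ
δ-diag i with i ≟ i
... | yes _   = ≈-refl
... | no  i≢i = contradiction refl i≢i

δ-off : {i j : Fin n} → i ≢ j → δ i j ≈ 0ℝ
δ-off {i = i} {j} i≢j with i ≟ j
... | yes i≡j = contradiction i≡j i≢j
... | no  _   = ≈-refl

∑-δ : (i : Fin n) (f : Vector ℝ n) → sum (λ j → δ i j * f j) ≈ f i
∑-δ {suc n} zero f = begin
  1ℝ * f zero + sum (λ j → 0ℝ * f (suc j))  ≈⟨ +-cong (R.*-identityˡ (f zero))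
                                                (sum-cong-≋ (λ j → R.zeroˡ (f (suc j)))) ⟩
  f zero + sum {n} (λ _ → 0ℝ)               ≈⟨ +-cong ≈-refl (sum-replicate-zero n) ⟩
  f zero + 0ℝ                               ≈⟨ R.+-identityʳ (f zero) ⟩
  f zero                                    ∎
  where open ≈-Reasoning
∑-δ {suc n} (suc i) f = begin
  0ℝ * f zero + sum (λ j → δ i j * f (suc j))  ≈⟨ +-cong (R.zeroˡ (f zero)) (∑-δ i (f ∘ suc)) ⟩
  0ℝ + f (suc i)                               ≈⟨ R.+-identityˡ (f (suc i)) ⟩
  f (suc i)                                    ∎
  where open ≈-Reasoning

-- The value of the quadratic form of M at eᵢ - eⱼ.
gap : Matrix n → Matrix n
gap M i j = (M i i + M j j) - (M i j + M j i)

sum-⊥𝐞 : (x : Vector ℝ n) → x ⊥ 𝐞 → sum x ≈ 0ℝ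
sum-⊥𝐞 x x⊥𝐞 = ≈-trans (sum-cong-≋ (λ i → ≈-sym (R.*-identityʳ (x i)))) x⊥𝐞

-- For Σ x = 0 the diagonal terms of gap M contribute nothing.
gap-polarisation : (M : Matrix n) {x : Vector ℝ n} → sum x ≈ 0ℝ →
  x · (gap M *ᵥ x) ≈ - (x · (M *ᵥ x) + x · (M *ᵥ x))
gap-polarisation {n} M {x} Σx≈0 = begin
  x · (gap M *ᵥ x)
    ≈⟨ sum-cong-≋ (λ i → ≈-trans (*-cong ≈-refl (row i)) (split i)) ⟩
  sum (λ i → x i * K - (x i * (M *ᵥ x) i + x i * (Mᵀ *ᵥ x) i))
    ≈⟨ ∑-distrib-- (λ i → x i * K) _ ⟩
  sum (λ i → x i * K) - sum (λ i → x i * (M *ᵥ x) i + x i * (Mᵀ *ᵥ x) i)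
    ≈⟨ +-cong (≈-sym (*-distribʳ-sum K x)) (-‿cong (∑-distrib-+ (λ i → x i * (M *ᵥ x) i) _)) ⟩
  sum x * K - (x · (M *ᵥ x) + x · (Mᵀ *ᵥ x))
    ≈⟨ +-cong (*-cong Σx≈0 ≈-refl) (-‿cong (+-cong ≈-refl transposed)) ⟩
  0ℝ * K - (x · (M *ᵥ x) + x · (M *ᵥ x))
    ≈⟨ seq≡⇒≈ (λ k → solve 2 (λ a b → con 0ℚ :* a :- b := :- b) refl (seq K k)
         (seq (x · (M *ᵥ x) + x · (M *ᵥ x)) k)) ⟩
  - (x · (M *ᵥ x) + x · (M *ᵥ x)) ∎
  where
  open ≈-Reasoning
  Mᵀ : Matrix n
  Mᵀ i j = M j i
  -- This part of a row sum is the same for every row, so the outer sum multiplies it by `sum x` and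
  -- it vanishes; the term with `M i i` vanishes within its row.
  K : ℝ
  K = sum (λ j → M j j * x j)
  transposed : x · (Mᵀ *ᵥ x) ≈ x · (M *ᵥ x)
  transposed = begin
    sum (λ i → x i * sum (λ j → M j i * x j))
      ≈⟨ sum-cong-≋ (λ i → *-distribˡ-sum (x i) (λ j → M j i * x j)) ⟩
    sum (λ i → sum (λ j → x i * (M j i * x j)))
      ≈⟨ ∑-comm (λ i j → x i * (M j i * x j)) ⟩
    sum (λ j → sum (λ i → x i * (M j i * x j)))
      ≈⟨ sum-cong-≋ (λ j → sum-cong-≋ (λ i → seq≡⇒≈ λ k →
           solve 3 (λ a b c → a :* (b :* c) := c :* (b :* a)) refl
             (seq (x i) k) (seq (M j i) k) (seq (x j) k))) ⟩
    sum (λ j → sum (λ i → x j * (M j i * x i)))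
      ≈⟨ sum-cong-≋ (λ j → *-distribˡ-sum (x j) (λ i → M j i * x i)) ⟨
    sum (λ j → x j * sum (λ i → M j i * x i)) ∎
  row : ∀ i → (gap M *ᵥ x) i ≈ K - ((M *ᵥ x) i + (Mᵀ *ᵥ x) i)
  row i = begin
    sum (λ j → gap M i j * x j)
      ≈⟨ sum-cong-≋ (λ j → seq≡⇒≈ λ k →
           solve 5 (λ a b c d y → ((a :+ b) :- (c :+ d)) :* y :=
                                  (a :* y :+ b :* y) :- (c :* y :+ d :* y)) refl
             (seq (M i i) k) (seq (M j j) k) (seq (M i j) k) (seq (M j i) k) (seq (x j) k)) ⟩
    sum (λ j → (M i i * x j + M j j * x j) - (M i j * x j + M j i * x j))
      ≈⟨ ∑-distrib-- (λ j → M i i * x j + M j j * x j) _ ⟩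
    sum (λ j → M i i * x j + M j j * x j) - sum (λ j → M i j * x j + M j i * x j)
      ≈⟨ +-cong (∑-distrib-+ (λ j → M i i * x j) _) (-‿cong (∑-distrib-+ (λ j → M i j * x j) _)) ⟩
    (sum (λ j → M i i * x j) + K) - ((M *ᵥ x) i + (Mᵀ *ᵥ x) i)
      ≈⟨ +-cong (+-cong (≈-trans (≈-sym (*-distribˡ-sum (M i i) x)) (*-cong ≈-refl Σx≈0)) ≈-refl)
           ≈-refl ⟩
    (M i i * 0ℝ + K) - ((M *ᵥ x) i + (Mᵀ *ᵥ x) i)
      ≈⟨ seq≡⇒≈ (λ k → solve 3 (λ a b c → (a :* con 0ℚ :+ b) :- c := b :- c) refl
           (seq (M i i) k) (seq K k) (seq ((M *ᵥ x) i + (Mᵀ *ᵥ x) i) k)) ⟩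
    K - ((M *ᵥ x) i + (Mᵀ *ᵥ x) i) ∎
  split : ∀ i → x i * (K - ((M *ᵥ x) i + (Mᵀ *ᵥ x) i)) ≈
                x i * K - (x i * (M *ᵥ x) i + x i * (Mᵀ *ᵥ x) i)
  split i = seq≡⇒≈ λ k → solve 4 (λ a b c d → a :* (b :- (c :+ d)) := a :* b :- (a :* c :+ a :* d)) refl
    (seq (x i) k) (seq K k) (seq ((M *ᵥ x) i) k) (seq ((Mᵀ *ᵥ x) i) k)

-- The diagonal of `gap M` is zero, so `gap M` is c (J - I) with J the all-ones matrix. J kills x,
-- hence `gap M` acts on x as -c, and the polarisation identity gives the form.
gap-const⇒form-const : (M : Matrix n) (c : ℝ) →
  (∀ {i j} → i ≢ j → gap M i j ≈ c) →
  ∀ x → x ⊥ 𝐞 → x · (M *ᵥ x) ≈ ½ℝ * (c * (x · x))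
gap-const⇒form-const M c gap≈c x x⊥𝐞 = begin
  q
    ≈⟨ seq≡⇒≈ (λ k → solve 1 (λ a → a := con ½ :* (:- (:- (a :+ a)))) refl (seq q k)) ⟩
  ½ℝ * (- (- (q + q)))
    ≈⟨ *-cong ≈-refl (-‿cong (gap-polarisation M Σx≈0)) ⟨
  ½ℝ * (- (x · (gap M *ᵥ x)))
    ≈⟨ *-cong ≈-refl (-‿cong (≈-trans (sum-cong-≋ (λ i → ≈-trans (*-cong ≈-refl (row i)) (swap i)))
         (≈-sym (*-distribˡ-sum (- c) (λ i → x i * x i))))) ⟩
  ½ℝ * (- (- c * (x · x)))
    ≈⟨ seq≡⇒≈ (λ k → solve 2 (λ a b → con ½ :* (:- (:- a :* b)) := con ½ :* (a :* b)) refl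
         (seq c k) (seq (x · x) k)) ⟩
  ½ℝ * (c * (x · x)) ∎
  where
  open ≈-Reasoning
  q : ℝ
  q = x · (M *ᵥ x)
  Σx≈0 : sum x ≈ 0ℝ
  Σx≈0 = sum-⊥𝐞 x x⊥𝐞
  gap≈ : ∀ i j → gap M i j ≈ c - c * δ i j
  gap≈ i j with i ≟ j
  ... | yes refl = seq≡⇒≈ λ k → solve 2 (λ a c → (a :+ a) :- (a :+ a) := c :- c :* con 1ℚ) refl
                     (seq (M i i) k) (seq c k)
  ... | no  i≢j  = ≈-trans (gap≈c i≢j)
                     (seq≡⇒≈ λ k → solve 1 (λ c → c := c :- c :* con 0ℚ) refl (seq c k))
  row : ∀ i → (gap M *ᵥ x) i ≈ - c * x i
  row i = begin
    sum (λ j → gap M i j * x j)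
      ≈⟨ sum-cong-≋ (λ j → ≈-trans (*-cong (gap≈ i j) ≈-refl) (seq≡⇒≈ λ k →
           solve 3 (λ c d y → (c :- c :* d) :* y := c :* y :- c :* (d :* y)) refl
             (seq c k) (seq (δ i j) k) (seq (x j) k))) ⟩
    sum (λ j → c * x j - c * (δ i j * x j))
      ≈⟨ ∑-distrib-- (λ j → c * x j) _ ⟩
    sum (λ j → c * x j) - sum (λ j → c * (δ i j * x j))
      ≈⟨ +-cong (*-distribˡ-sum c x) (-‿cong (*-distribˡ-sum c (λ j → δ i j * x j))) ⟨
    c * sum x - c * sum (λ j → δ i j * x j)
      ≈⟨ +-cong (*-cong ≈-refl Σx≈0) (-‿cong (*-cong ≈-refl (∑-δ i x))) ⟩
    c * 0ℝ - c * x i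
      ≈⟨ seq≡⇒≈ (λ k → solve 2 (λ c y → c :* con 0ℚ :- c :* y := :- c :* y) refl
           (seq c k) (seq (x i) k)) ⟩
    - c * x i ∎
  swap : ∀ i → x i * (- c * x i) ≈ - c * (x i * x i)
  swap i = seq≡⇒≈ λ k → solve 2 (λ a c → a :* (:- c :* a) := :- c :* (a :* a)) refl
    (seq (x i) k) (seq c k)

-- The unit vectors (eᵢ - eⱼ)/√2

pair : Fin n → Fin n → Vector ℝ n
pair i j k = √½ * (δ i k - δ j k)

pair-· : (i j : Fin n) (f : Vector ℝ n) → pair i j · f ≈ √½ * (f i - f j)
pair-· i j f = begin
  sum (λ k → √½ * (δ i k - δ j k) * f k)
    ≈⟨ sum-cong-≋ (λ k → seq≡⇒≈ λ l → solve 4 (λ r a b c → r :* (a :- b) :* c :=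
         r :* (a :* c :- b :* c)) refl
         (seq √½ l) (seq (δ i k) l) (seq (δ j k) l) (seq (f k) l)) ⟩
  sum (λ k → √½ * (δ i k * f k - δ j k * f k))
    ≈⟨ *-distribˡ-sum √½ (λ k → δ i k * f k - δ j k * f k) ⟨
  √½ * sum (λ k → δ i k * f k - δ j k * f k)
    ≈⟨ *-cong ≈-refl (∑-distrib-- (λ k → δ i k * f k) _) ⟩
  √½ * (sum (λ k → δ i k * f k) - sum (λ k → δ j k * f k))
    ≈⟨ *-cong ≈-refl (+-cong (∑-δ i f) (-‿cong (∑-δ j f))) ⟩
  √½ * (f i - f j) ∎
  where open ≈-Reasoning

pair-form : (M : Matrix n) (i j : Fin n) →
  pair i j · (M *ᵥ pair i j) ≈ ½ℝ * gap M i j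
pair-form M i j = begin
  pair i j · (M *ᵥ pair i j)
    ≈⟨ pair-· i j (M *ᵥ pair i j) ⟩
  √½ * ((M *ᵥ pair i j) i - (M *ᵥ pair i j) j)
    ≈⟨ *-cong ≈-refl (+-cong (entry i) (-‿cong (entry j))) ⟩
  √½ * (√½ * (M i i - M i j) - √½ * (M j i - M j j))
    ≈⟨ seq≡⇒≈ (λ k → solve 5 (λ r a b c d → r :* (r :* (a :- b) :- r :* (c :- d)) :=
         r :* r :* ((a :+ d) :- (b :+ c))) refl
         (seq √½ k) (seq (M i i) k) (seq (M i j) k) (seq (M j i) k) (seq (M j j) k)) ⟩
  √½ * √½ * gap M i j
    ≈⟨ *-cong √½*√½≈½ ≈-refl ⟩
  ½ℝ * gap M i j ∎
  where
  open ≈-Reasoning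
  entry : ∀ l → (M *ᵥ pair i j) l ≈ √½ * (M l i - M l j)
  entry l = ≈-trans (sum-cong-≋ (λ k → R.*-comm (M l k) (pair i j k))) (pair-· i j (M l))

pair-admissible : (i j : Fin n) → i ≢ j → Admissible (pair i j)
pair-admissible i j i≢j =
    ≈-trans (pair-· i j 𝐞)
      (seq≡⇒≈ λ k → solve 1 (λ r → r :* (con 1ℚ :- con 1ℚ) := con 0ℚ) refl (seq √½ k))
  , fromℚ-mono (toWitness {a? = 0ℚ ℚₚ.≤? 1ℚ} _)
  , (begin
  1ℝ * 1ℝ
    ≈⟨ seq≡⇒≈ (λ _ → refl) ⟩
  -- The number 1 spelled out with the values of the four Kronecker deltas that occur in the squared
  -- norm; the two rationals agree by computation.
  ½ℝ * ((1ℝ - 0ℝ) - (0ℝ - 1ℝ))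
    ≈⟨ *-cong √½*√½≈½ (+-cong (+-cong (δ-diag i) (-‿cong (δ-off (i≢j ∘ sym))))
         (-‿cong (+-cong (δ-off i≢j) (-‿cong (δ-diag j))))) ⟨
  √½ * √½ * ((δ i i - δ j i) - (δ i j - δ j j))
    ≈⟨ seq≡⇒≈ (λ k → solve 5 (λ r a b c d → r :* r :* ((a :- b) :- (c :- d)) :=
         r :* (r :* (a :- b) :- r :* (c :- d))) refl
         (seq √½ k) (seq (δ i i) k) (seq (δ j i) k) (seq (δ i j) k) (seq (δ j j) k)) ⟩
  √½ * (pair i j i - pair i j j)
    ≈⟨ pair-· i j (pair i j) ⟨
  pair i j · pair i j ∎)
  where open ≈-Reasoning

-- The Laplacian spread

toℕ : Bool → ℕ
toℕ b = if b then 1 else 0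

arcs weight : Digraph n → Fin n → Fin n → ℕ
arcs   Γ i j = toℕ (edge Γ i j) ℕ.+ toℕ (edge Γ j i)
weight Γ i j = d⁺ Γ i ℕ.+ d⁺ Γ j ℕ.+ arcs Γ i j

ConstantWeight : Digraph n → Set
ConstantWeight Γ = ∃[ w ] ∀ i j → i ≢ j → weight Γ i j ≡ w

laplacian-gap : (Γ : Digraph n) {i j : Fin n} → i ≢ j →
  gap (laplacian Γ) i j ≈ fromℕ (weight Γ i j)
laplacian-gap Γ {i} {j} i≢j = begin
  gap (laplacian Γ) i j
    ≈⟨ +-cong (+-cong (diag i) (diag j)) (-‿cong (+-cong (off i≢j) (off (i≢j ∘ sym)))) ⟩
  (dᵢ + dⱼ) - (- fromℕ aᵢⱼ + - fromℕ aⱼᵢ)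
    ≈⟨ seq≡⇒≈ (λ _ → solve 4 (λ a b c d → (a :+ b) :- (:- c :+ :- d) := (a :+ b) :+ (c :+ d)) refl
         (ℕ→ℚ (d⁺ Γ i)) (ℕ→ℚ (d⁺ Γ j)) (ℕ→ℚ aᵢⱼ) (ℕ→ℚ aⱼᵢ)) ⟩
  (dᵢ + dⱼ) + (fromℕ aᵢⱼ + fromℕ aⱼᵢ)
    ≈⟨ seq≡⇒≈ (λ _ → sym (trans (ℕ→ℚ-homo-+ (d⁺ Γ i ℕ.+ d⁺ Γ j) (aᵢⱼ ℕ.+ aⱼᵢ))
         (cong₂ ℚ._+_ (ℕ→ℚ-homo-+ (d⁺ Γ i) (d⁺ Γ j)) (ℕ→ℚ-homo-+ aᵢⱼ aⱼᵢ)))) ⟩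
  fromℕ (weight Γ i j) ∎
  where
  open ≈-Reasoning
  dᵢ dⱼ : ℝ
  dᵢ = fromℕ (d⁺ Γ i)
  dⱼ = fromℕ (d⁺ Γ j)
  aᵢⱼ aⱼᵢ : ℕ
  aᵢⱼ = toℕ (edge Γ i j)
  aⱼᵢ = toℕ (edge Γ j i)
  if-true : ∀ {b x y} → b ≡ true → (if b then x else y) ≈ x
  if-true refl = ≈-refl
  if-false : ∀ {b x y} → b ≡ false → (if b then x else y) ≈ y
  if-false refl = ≈-refl
  if-toℕ : ∀ b → (if b then 1ℝ else 0ℝ) ≈ fromℕ (toℕ b)
  if-toℕ true  = ≈-refl
  if-toℕ false = ≈-refl
  diag : ∀ l → laplacian Γ l l ≈ fromℕ (d⁺ Γ l)
  diag l = ≈-trans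
    (+-cong (if-true (dec-true (l ≟ l) refl)) (-‿cong (if-false (noLoop Γ l))))
    (seq≡⇒≈ λ _ → ℚₚ.+-identityʳ (ℕ→ℚ (d⁺ Γ l)))
  off : ∀ {l m} → l ≢ m → laplacian Γ l m ≈ - fromℕ (toℕ (edge Γ l m))
  off {l} {m} l≢m = ≈-trans
    (+-cong (if-false (dec-false (l ≟ m) l≢m)) (-‿cong (if-toℕ (edge Γ l m))))
    (R.+-identityˡ _)

½-cancel : ∀ {x y} → ½ℝ * x ≈ ½ℝ * y → x ≈ y
½-cancel {x} {y} p = ≈-trans (≈-sym (double x)) (≈-trans (+-cong p p) (double y))
  where
  double : ∀ z → ½ℝ * z + ½ℝ * z ≈ z
  double z = seq≡⇒≈ λ k → solve 1 (λ a → con ½ :* a :+ con ½ :* a := a) refl (seq z k)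

-- Every value lies between α and β, and a zero spread makes these two equal.
spread≈0⇒form≈α : (Γ : Digraph n) → IsSpread Γ 0ℝ →
  ∃[ a ] ∀ x → Admissible x → quadraticForm Γ x ≈ a
spread≈0⇒form≈α Γ (a , b , (_ , a≤) , (_ , ≤b) , 0≈b-a) = a , λ x adm →
  ≤-antisym (≤-trans (≤b x adm) (≈⇒≤ b≈a)) (a≤ x adm)
  where
  b≈a : b ≈ a
  b≈a = ≈-trans (seq≡⇒≈ λ k → solve 2 (λ b a → b := (b :- a) :+ a) refl (seq b k) (seq a k))
       (≈-trans (+-cong (≈-sym 0≈b-a) ≈-refl) (R.+-identityˡ a))

-- At `pair i j` the constant form takes half the weight of i and j. All pairs are compared with the
-- vertices 0 and 1, which exist since n ≥ 2.
spread≈0⇒constantWeight : (Γ : Digraph n) → 2 ≤ℕ n → IsSpread Γ 0ℝ → ConstantWeight Γ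
spread≈0⇒constantWeight {suc (suc n)} Γ (ℕ.s≤s (ℕ.s≤s _)) sp =
  weight Γ zero (suc zero) , λ i j i≢j →
    fromℕ-injective (½-cancel {fromℕ (weight Γ i j)} {fromℕ (weight Γ zero (suc zero))}
      (≈-trans (half-weight i j i≢j) (≈-sym (half-weight zero (suc zero) λ ()))))
  where
  a : ℝ
  a = proj₁ (spread≈0⇒form≈α Γ sp)
  half-weight : ∀ i j → i ≢ j → ½ℝ * fromℕ (weight Γ i j) ≈ a
  half-weight i j i≢j = begin
    ½ℝ * fromℕ (weight Γ i j)      ≈⟨ *-cong ≈-refl (laplacian-gap Γ i≢j) ⟨
    ½ℝ * gap (laplacian Γ) i j     ≈⟨ pair-form (laplacian Γ) i j ⟨
    quadraticForm Γ (pair i j)     ≈⟨ proj₂ (spread≈0⇒form≈α Γ sp) (pair i j) (pair-admissible i j i≢j) ⟩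
    a                              ∎
    where open ≈-Reasoning

constantWeight⇒spread≈0 : (Γ : Digraph n) → 2 ≤ℕ n → ConstantWeight Γ → IsSpread Γ 0ℝ
constantWeight⇒spread≈0 {n@(suc (suc _))} Γ (ℕ.s≤s (ℕ.s≤s _)) (w , weight≡w) =
  c , c
  , (attained , λ x adm → ≈⇒≤ (≈-sym (form≈c x adm)))
  , (attained , λ x adm → ≈⇒≤ (form≈c x adm))
  , ≈-sym (R.-‿inverseʳ c)
  where
  c : ℝ
  -- The factor `1ℝ * 1ℝ` stands for x · x in the shape in which admissibility provides it.
  c = ½ℝ * (fromℕ w * (1ℝ * 1ℝ))
  form≈c : ∀ x → Admissible x → quadraticForm Γ x ≈ c
  form≈c x (x⊥𝐞 , _ , 1≈x·x) = ≈-trans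
    (gap-const⇒form-const (laplacian Γ) (fromℕ w) (λ {i} {j} i≢j →
      subst (λ v → gap (laplacian Γ) i j ≈ fromℕ v) (weight≡w i j i≢j) (laplacian-gap Γ i≢j)) x x⊥𝐞)
    (*-cong ≈-refl (*-cong ≈-refl (≈-sym 1≈x·x)))
  e₀-e₁ : Vector ℝ n
  e₀-e₁ = pair zero (suc zero)
  e₀-e₁-admissible : Admissible e₀-e₁
  e₀-e₁-admissible = pair-admissible {n} zero (suc zero) λ ()
  attained : ∃[ x ] Admissible x × quadraticForm Γ x ≈ c
  attained = e₀-e₁ , e₀-e₁-admissible , form≈c e₀-e₁ e₀-e₁-admissible

-- Counting

-- Cardinality as a sum, so that degrees can be added, compared entry by entry, and double counted
-- by exchanging sums.
size : (Fin n → Bool) → ℕ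
size p = ∑ℕ.sum (toℕ ∘ p)

∣tabulate∣≡size : (p : Fin n → Bool) → ∣ tabulate p ∣ ≡ size p
∣tabulate∣≡size {zero}  p = refl
∣tabulate∣≡size {suc n} p with p zero
... | true  = cong suc (∣tabulate∣≡size (p ∘ suc))
... | false = ∣tabulate∣≡size (p ∘ suc)

_⊑_ : (p q : Fin n → Bool) → Set
p ⊑ q = ∀ i → p i ≡ true → q i ≡ true

size-mono : {p q : Fin n → Bool} → p ⊑ q → size p ℕ.≤ size q
size-mono {zero}  p⊑q = ℕ.z≤n
size-mono {suc n} {p} {q} p⊑q = ℕₚ.+-mono-≤ (head (p zero) (q zero) (p⊑q zero))
  (size-mono (p⊑q ∘ suc))
  where
  head : ∀ b c → (b ≡ true → c ≡ true) → toℕ b ℕ.≤ toℕ c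
  head false _ _ = ℕ.z≤n
  head true  c f = ℕₚ.≤-reflexive (cong toℕ (sym (f refl)))

-- Turns an inclusion and a count into equality of sets. It serves to show that out-neighbours
-- exhaust a given set, and that a vertex of out-degree n would have a loop.
⊑-antisym-size : {p q : Fin n → Bool} → p ⊑ q → size q ℕ.≤ size p → q ⊑ p
⊑-antisym-size {suc n} {p} {q} p⊑q ∣q∣≤∣p∣ with p zero in p₀ | q zero in q₀
... | true  | false = contradiction (trans (sym q₀) (p⊑q zero p₀)) λ ()
... | false | true  = contradiction (ℕₚ.≤-trans ∣q∣≤∣p∣ (size-mono (p⊑q ∘ suc))) (ℕₚ.<-irrefl refl)
... | true  | true  = λ where
  zero    _  → p₀
  (suc i) qᵢ → ⊑-antisym-size (p⊑q ∘ suc) (ℕ.s≤s⁻¹ ∣q∣≤∣p∣) i qᵢ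
... | false | false = λ where
  zero    q₀′ → contradiction (trans (sym q₀) q₀′) λ ()
  (suc i) qᵢ  → ⊑-antisym-size (p⊑q ∘ suc) ∣q∣≤∣p∣ i qᵢ

∑-const : ∀ n c → ∑ℕ.sum {n} (λ _ → c) ≡ n ℕ.* c
∑-const zero    c = refl
∑-const (suc n) c = cong (c ℕ.+_) (∑-const n c)

-- Both sides are the common sum away from i plus `f i` and `g i`; the crossed form avoids
-- subtraction in ℕ. It is meant for rows of the adjacency matrix that follow a pattern except at
-- one entry.
∑-agree-off : (i : Fin n) (f g : Fin n → ℕ) → (∀ j → i ≢ j → f j ≡ g j) →
  ∑ℕ.sum f ℕ.+ g i ≡ ∑ℕ.sum g ℕ.+ f i
∑-agree-off {suc n} i f g f≡g = begin
  ∑ℕ.sum f ℕ.+ g i                                ≡⟨ cong (ℕ._+ g i) (∑ℕ.sum-remove {i = i} f) ⟩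
  f i ℕ.+ ∑ℕ.sum (removeAt f i) ℕ.+ g i           ≡⟨ cong (λ s → f i ℕ.+ s ℕ.+ g i) (∑ℕ.sum-cong-≗ rest) ⟩
  f i ℕ.+ ∑ℕ.sum (removeAt g i) ℕ.+ g i           ≡⟨ ℕ-Ring.solve 3 (λ a s b →
                                                     a ℕ-Ring.:+ s ℕ-Ring.:+ b ℕ-Ring.:= b ℕ-Ring.:+ s ℕ-Ring.:+ a) refl
                                                     (f i) (∑ℕ.sum (removeAt g i)) (g i) ⟩
  g i ℕ.+ ∑ℕ.sum (removeAt g i) ℕ.+ f i           ≡⟨ cong (ℕ._+ f i) (∑ℕ.sum-remove {i = i} g) ⟨
  ∑ℕ.sum g ℕ.+ f i                                ∎
  where
  open ≡-Reasoning
  rest : ∀ k → removeAt f i k ≡ removeAt g i k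
  rest k = f≡g (punchIn i k) (punchInᵢ≢i i k ∘ sym)

-- Digraphs of constant weight

-- Up to isomorphism, B is the complete part of an imploding star.
StarSet : Digraph n → (Fin n → Bool) → Set
StarSet Γ B = ∀ i j → i ≢ j → edge Γ i j ≡ B j

d⁺≡size : (Γ : Digraph n) (i : Fin n) → d⁺ Γ i ≡ size (edge Γ i)
d⁺≡size Γ i = ∣tabulate∣≡size (edge Γ i)

-- A vertex of B has one out-neighbour fewer than a vertex outside, as it is not its own neighbour.
-- The arcs between i and j number [i ∈ B] + [j ∈ B], which makes up exactly for the two losses.
starSet⇒constantWeight : (Γ : Digraph n) {B : Fin n → Bool} → StarSet Γ B → ConstantWeight Γ
starSet⇒constantWeight Γ {B} star = size B ℕ.+ size B , λ i j i≢j → begin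
  d⁺ Γ i ℕ.+ d⁺ Γ j ℕ.+ (toℕ (edge Γ i j) ℕ.+ toℕ (edge Γ j i))
    ≡⟨ cong₂ (λ a b → d⁺ Γ i ℕ.+ d⁺ Γ j ℕ.+ (toℕ a ℕ.+ toℕ b)) (star i j i≢j) (star j i (i≢j ∘ sym)) ⟩
  d⁺ Γ i ℕ.+ d⁺ Γ j ℕ.+ (toℕ (B j) ℕ.+ toℕ (B i))
    ≡⟨ ℕ-Ring.solve 4 (λ a b c d → a ℕ-Ring.:+ b ℕ-Ring.:+ (c ℕ-Ring.:+ d) ℕ-Ring.:=
         (a ℕ-Ring.:+ d) ℕ-Ring.:+ (b ℕ-Ring.:+ c)) refl
         (d⁺ Γ i) (d⁺ Γ j) (toℕ (B j)) (toℕ (B i)) ⟩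
  (d⁺ Γ i ℕ.+ toℕ (B i)) ℕ.+ (d⁺ Γ j ℕ.+ toℕ (B j))
    ≡⟨ cong₂ ℕ._+_ (degree i) (degree j) ⟩
  size B ℕ.+ size B ∎
  where
  open ≡-Reasoning
  degree : ∀ i → d⁺ Γ i ℕ.+ toℕ (B i) ≡ size B
  degree i = begin
    d⁺ Γ i ℕ.+ toℕ (B i)              ≡⟨ cong (ℕ._+ toℕ (B i)) (d⁺≡size Γ i) ⟩
    size (edge Γ i) ℕ.+ toℕ (B i)     ≡⟨ ∑-agree-off i _ _ (λ j i≢j → cong toℕ (star i j i≢j)) ⟩
    size B ℕ.+ toℕ (edge Γ i i)       ≡⟨ cong (λ b → size B ℕ.+ toℕ b) (noLoop Γ i) ⟩
    size B ℕ.+ 0                      ≡⟨ ℕₚ.+-identityʳ (size B) ⟩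
    size B                            ∎

tournament⇒arcs≡1 : (Γ : Digraph n) → IsTournament Γ → ∀ i j → i ≢ j → arcs Γ i j ≡ 1
tournament⇒arcs≡1 Γ tour i j i≢j with edge Γ i j | edge Γ j i | tour i j i≢j
... | .false | true  | refl = refl
... | .true  | false | refl = refl

regularTournament⇒constantWeight : (Γ : Digraph n) → IsRegularTournament Γ → ConstantWeight Γ
regularTournament⇒constantWeight {n} Γ (_ , _ , tour , regular) =
  h ℕ.+ h ℕ.+ 1 , λ i j i≢j → cong₂ ℕ._+_
    (cong₂ ℕ._+_ (proj₂ (regular i)) (proj₂ (regular j))) (tournament⇒arcs≡1 Γ tour i j i≢j)
  where
  h : ℕ
  h = (n ℕ.∸ 1) / 2

arcs≤2 : (Γ : Digraph n) (i j : Fin n) → arcs Γ i j ℕ.≤ 2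
arcs≤2 Γ i j with edge Γ i j | edge Γ j i
... | true  | true  = ℕₚ.≤-refl
... | true  | false = ℕ.s≤s ℕ.z≤n
... | false | true  = ℕ.s≤s ℕ.z≤n
... | false | false = ℕ.z≤n

arcs-comm : (Γ : Digraph n) (i j : Fin n) → arcs Γ i j ≡ arcs Γ j i
arcs-comm Γ i j = ℕₚ.+-comm (toℕ (edge Γ i j)) (toℕ (edge Γ j i))

arcs≡0⇒¬edge : (Γ : Digraph n) (i j : Fin n) → arcs Γ i j ≡ 0 → edge Γ i j ≡ false
arcs≡0⇒¬edge Γ i j p with edge Γ i j
... | false = refl

arcs≡2⇒edge : (Γ : Digraph n) (i j : Fin n) → arcs Γ i j ≡ 2 → edge Γ i j ≡ true
arcs≡2⇒edge Γ i j p with edge Γ i j | edge Γ j i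
... | true  | _ = refl
... | false | false = contradiction p λ ()
... | false | true  = contradiction p λ ()

arcs≡1⇒opposite : (Γ : Digraph n) (i j : Fin n) → arcs Γ i j ≡ 1 → edge Γ i j ≡ not (edge Γ j i)
arcs≡1⇒opposite Γ i j p with edge Γ i j | edge Γ j i
... | true  | false = refl
... | false | true  = refl
... | true  | true  = contradiction p λ ()
... | false | false = contradiction p λ ()

arcs-values : (Γ : Digraph n) (i j : Fin n) →
  arcs Γ i j ≡ 0 ⊎ arcs Γ i j ≡ 1 ⊎ arcs Γ i j ≡ 2
arcs-values Γ i j with arcs Γ i j | arcs≤2 Γ i j
... | 0 | _ = inj₁ refl
... | 1 | _ = inj₂ (inj₁ refl)
... | 2 | _ = inj₂ (inj₂ refl)
... | suc (suc (suc _)) | ℕ.s≤s (ℕ.s≤s ())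

-- Counting the arcs by tails and by heads gives n d = n (n - 1 - d).
equalDegrees⇒regular : (Γ : Digraph n) (d : ℕ) → 2 ≤ℕ n → IsTournament Γ →
  (∀ i → d⁺ Γ i ≡ d) → IsRegularTournament Γ
equalDegrees⇒regular {n@(suc m)} Γ d 2≤n tour d⁺≡d = 3≤n , odd , tour , λ i →
  trans (d⁻≡m∸d i) (trans m∸d≡d half) , trans (d⁺≡d i) half
  where
  open ≡-Reasoning
  d⁻≡size : ∀ i → d⁻ Γ i ≡ size (λ j → edge Γ j i)
  d⁻≡size i = ∣tabulate∣≡size (λ j → edge Γ j i)
  -- At i itself the row of arcs has 0 where the constant row has 1; this is the 1 added on both
  -- sides.
  d⁺+d⁻ : ∀ i → d⁺ Γ i ℕ.+ d⁻ Γ i ≡ m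
  d⁺+d⁻ i = ℕₚ.+-cancelʳ-≡ 1 _ _ (begin
    d⁺ Γ i ℕ.+ d⁻ Γ i ℕ.+ 1
      ≡⟨ cong (ℕ._+ 1) (cong₂ ℕ._+_ (d⁺≡size Γ i) (d⁻≡size i)) ⟩
    size (edge Γ i) ℕ.+ size (λ j → edge Γ j i) ℕ.+ 1
      ≡⟨ cong (ℕ._+ 1) (∑ℕ.∑-distrib-+ (toℕ ∘ edge Γ i) (λ j → toℕ (edge Γ j i))) ⟨
    ∑ℕ.sum (arcs Γ i) ℕ.+ 1
      ≡⟨ ∑-agree-off i (arcs Γ i) (λ _ → 1) (tournament⇒arcs≡1 Γ tour i) ⟩
    ∑ℕ.sum {n} (λ _ → 1) ℕ.+ arcs Γ i i
      ≡⟨ cong₂ ℕ._+_ (trans (∑-const n 1) (ℕₚ.*-identityʳ n))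
           (cong (λ b → toℕ b ℕ.+ toℕ b) (noLoop Γ i)) ⟩
    n ℕ.+ 0
      ≡⟨ trans (ℕₚ.+-identityʳ n) (ℕₚ.+-comm 1 m) ⟩
    m ℕ.+ 1 ∎)
  d⁻≡m∸d : ∀ i → d⁻ Γ i ≡ m ℕ.∸ d
  d⁻≡m∸d i = begin
    d⁻ Γ i                          ≡⟨ ℕₚ.m+n∸m≡n d (d⁻ Γ i) ⟨
    d ℕ.+ d⁻ Γ i ℕ.∸ d              ≡⟨ cong (λ e → e ℕ.+ d⁻ Γ i ℕ.∸ d) (d⁺≡d i) ⟨
    d⁺ Γ i ℕ.+ d⁻ Γ i ℕ.∸ d         ≡⟨ cong (ℕ._∸ d) (d⁺+d⁻ i) ⟩
    m ℕ.∸ d                         ∎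
  m∸d≡d : m ℕ.∸ d ≡ d
  m∸d≡d = ℕₚ.*-cancelˡ-≡ _ _ n (begin
    n ℕ.* (m ℕ.∸ d)                               ≡⟨ ∑-const n (m ℕ.∸ d) ⟨
    ∑ℕ.sum {n} (λ _ → m ℕ.∸ d)                    ≡⟨ ∑ℕ.sum-cong-≗ (λ i → trans (sym (d⁻≡m∸d i)) (d⁻≡size i)) ⟩
    ∑ℕ.sum (λ i → size (λ j → edge Γ j i))        ≡⟨ ∑ℕ.∑-comm (λ i j → toℕ (edge Γ j i)) ⟩
    ∑ℕ.sum (λ j → size (edge Γ j))                ≡⟨ ∑ℕ.sum-cong-≗ (λ j → trans (sym (d⁺≡size Γ j)) (d⁺≡d j)) ⟩
    ∑ℕ.sum {n} (λ _ → d)                          ≡⟨ ∑-const n d ⟩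
    n ℕ.* d                                       ∎)
  m≡d*2 : m ≡ d ℕ.* 2
  m≡d*2 = begin
    m                          ≡⟨ d⁺+d⁻ zero ⟨
    d⁺ Γ zero ℕ.+ d⁻ Γ zero    ≡⟨ cong₂ ℕ._+_ (d⁺≡d zero) (trans (d⁻≡m∸d zero) m∸d≡d) ⟩
    d ℕ.+ d                    ≡⟨ cong (d ℕ.+_) (ℕₚ.+-identityʳ d) ⟨
    2 ℕ.* d                    ≡⟨ ℕₚ.*-comm 2 d ⟩
    d ℕ.* 2                    ∎
  half : d ≡ m / 2
  half = trans (sym (m*n/n≡m d 2)) (cong (_/ 2) (sym m≡d*2))
  odd : n % 2 ≡ 1
  odd = trans (cong (λ k → suc k % 2) m≡d*2) ([m+kn]%n≡m%n 1 d 2)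
  3≤n : 3 ≤ℕ n
  -- Since n = 2d + 1, the bound n ≥ 2 excludes d = 0.
  3≤n = atLeast3 d m≡d*2 2≤n
    where
    atLeast3 : ∀ e {l} → l ≡ e ℕ.* 2 → 2 ≤ℕ suc l → 3 ≤ℕ suc l
    atLeast3 zero    refl (ℕ.s≤s ())
    atLeast3 (suc e) refl _ = ℕ.s≤s (ℕ.s≤s (ℕ.s≤s ℕ.z≤n))

-- Structure of digraphs of constant weight

module _ (Γ : Digraph n) (w : ℕ) (weight≡w : ∀ i j → i ≢ j → weight Γ i j ≡ w) where

  private
    d : Fin n → ℕ
    d = d⁺ Γ

  d+arcs-const : ∀ {i j k} → i ≢ k → j ≢ k → d i ℕ.+ arcs Γ i k ≡ d j ℕ.+ arcs Γ j k
  d+arcs-const {i} {j} {k} i≢k j≢k = ℕₚ.+-cancelˡ-≡ (d k) _ _ (trans (swap i)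
    (trans (weight≡w i k i≢k) (sym (trans (swap j) (weight≡w j k j≢k)))))
    where
    swap : ∀ l → d k ℕ.+ (d l ℕ.+ arcs Γ l k) ≡ weight Γ l k
    swap l = trans (sym (ℕₚ.+-assoc (d k) (d l) _)) (cong (ℕ._+ arcs Γ l k) (ℕₚ.+-comm (d k) (d l)))

  -- Suppose d j ≥ d i + 2. For every other k, d j + arcs j k = d i + arcs i k ≤ d i + 2 ≤ d j, so
  -- no arc joins j and k. Only i can be an out-neighbour of j, whence d j ≤ 1, a contradiction.
  degrees-differ-by-1 : ∀ {i j} → d i ℕ.< d j → d j ≡ suc (d i)
  degrees-differ-by-1 {i} {j} dᵢ<dⱼ with suc (d i) ℕₚ.≟ d j
  ... | yes eq = sym eq
  ... | no  ne = contradiction dⱼ≤1 (ℕₚ.<⇒≱ (ℕₚ.≤-trans (ℕ.s≤s (ℕ.s≤s ℕ.z≤n)) 2+dᵢ≤dⱼ))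
    where
    2+dᵢ≤dⱼ : 2 ℕ.+ d i ℕ.≤ d j
    2+dᵢ≤dⱼ = ℕₚ.≤∧≢⇒< dᵢ<dⱼ ne
    arcs≡0 : ∀ k → i ≢ k → j ≢ k → arcs Γ j k ≡ 0
    arcs≡0 k i≢k j≢k = ℕₚ.n≤0⇒n≡0 (ℕₚ.+-cancelˡ-≤ (d j) _ _ (begin
      d j ℕ.+ arcs Γ j k    ≡⟨ d+arcs-const j≢k i≢k ⟩
      d i ℕ.+ arcs Γ i k    ≤⟨ ℕₚ.+-monoʳ-≤ (d i) (arcs≤2 Γ i k) ⟩
      d i ℕ.+ 2             ≡⟨ ℕₚ.+-comm (d i) 2 ⟩
      2 ℕ.+ d i             ≤⟨ 2+dᵢ≤dⱼ ⟩
      d j                   ≡⟨ ℕₚ.+-identityʳ (d j) ⟨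
      d j ℕ.+ 0             ∎))
      where open ℕₚ.≤-Reasoning
    ¬edge : ∀ k → i ≢ k → edge Γ j k ≡ false
    ¬edge k i≢k with j ≟ k
    ... | yes refl = noLoop Γ j
    ... | no  j≢k  = arcs≡0⇒¬edge Γ j k (arcs≡0 k i≢k j≢k)
    toℕ≤1 : ∀ b → toℕ b ℕ.≤ 1
    toℕ≤1 true  = ℕₚ.≤-refl
    toℕ≤1 false = ℕ.z≤n
    dⱼ≤1 : d j ℕ.≤ 1
    dⱼ≤1 = begin
      d j                                        ≡⟨ d⁺≡size Γ j ⟩
      size (edge Γ j)                            ≡⟨ ℕₚ.+-identityʳ _ ⟨
      size (edge Γ j) ℕ.+ 0                      ≡⟨ ∑-agree-off i (toℕ ∘ edge Γ j) (λ _ → 0)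
                                                      (λ k i≢k → cong toℕ (¬edge k i≢k)) ⟩
      ∑ℕ.sum {n} (λ _ → 0) ℕ.+ toℕ (edge Γ j i)  ≡⟨ cong (ℕ._+ toℕ (edge Γ j i))
                                                      (trans (∑-const n 0) (ℕₚ.*-zeroʳ n)) ⟩
      toℕ (edge Γ j i)                           ≤⟨ toℕ≤1 (edge Γ j i) ⟩
      1                                          ∎
      where open ℕₚ.≤-Reasoning

  -- The case of unequal out-degrees

  module _ {a b : Fin n} (d-b<d-a : d b ℕ.< d a) where

    private
      b≢a : b ≢ a
      b≢a refl = ℕₚ.<-irrefl refl d-b<d-a
      d-a : d a ≡ suc (d b)
      d-a = degrees-differ-by-1 d-b<d-a

    -- Without arcs between a and b, an out-neighbour k of a satisfies d k + 1 ≤ d k + arcs k a = d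
    -- b, so its degree is at least two below d a, which is excluded. Hence a has out-degree 0, yet
    -- d b < d a.
    arcs≢0 : arcs Γ a b ≢ 0
    arcs≢0 arcs≡0 = contradiction d-b<d-a (ℕₚ.≤⇒≯ (ℕₚ.≤-trans (ℕₚ.≤-reflexive d-a≡0) ℕ.z≤n))
      where
      ¬edge : ∀ k → edge Γ a k ≡ false
      ¬edge k with a ≟ k | b ≟ k
      ... | yes refl | _        = noLoop Γ a
      ... | no  _    | yes refl = arcs≡0⇒¬edge Γ a b arcs≡0
      ... | no  a≢k  | no  _ with edge Γ a k in e
      ...   | false = refl
      ...   | true  = contradiction (subst₂ ℕ._<_ refl (degrees-differ-by-1 (ℕₚ.<-trans d-k<d-b d-b<d-a)) d-b<d-a)
                        (ℕₚ.≤⇒≯ d-k<d-b)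
        where
        d-k<d-b : d k ℕ.< d b
        d-k<d-b = begin
          suc (d k)             ≡⟨ ℕₚ.+-comm 1 (d k) ⟩
          d k ℕ.+ 1             ≤⟨ ℕₚ.+-monoʳ-≤ (d k) (subst (λ c → 1 ℕ.≤ toℕ (edge Γ k a) ℕ.+ toℕ c)
                                     (sym e) (ℕₚ.m≤n+m 1 _)) ⟩
          d k ℕ.+ arcs Γ k a    ≡⟨ d+arcs-const (a≢k ∘ sym) b≢a ⟩
          d b ℕ.+ arcs Γ b a    ≡⟨ cong (d b ℕ.+_) (trans (arcs-comm Γ b a) arcs≡0) ⟩
          d b ℕ.+ 0             ≡⟨ ℕₚ.+-identityʳ (d b) ⟩
          d b                   ∎
          where open ℕₚ.≤-Reasoning
      d-a≡0 : d a ≡ 0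
      d-a≡0 = trans (d⁺≡size Γ a) (trans (∑ℕ.sum-cong-≗ (cong toℕ ∘ ¬edge))
        (trans (∑-const n 0) (ℕₚ.*-zeroʳ n)))

    -- With two arcs, d k + arcs k b = d b + 3 for every other k, so d k > d b, hence d k = d b + 1
    -- and arcs k b = 2. Then b dominates all other vertices and d a = d b + 1 = n, which would give
    -- a loop at a.
    arcs≢2 : arcs Γ a b ≢ 2
    arcs≢2 arcs≡2 = contradiction
      (trans (sym (noLoop Γ a)) (⊑-antisym-size {p = edge Γ a} {λ _ → true} (λ _ _ → refl)
        (ℕₚ.≤-reflexive (sym (trans (sym (d⁺≡size Γ a)) d-a≡n))) a refl)) λ ()
      where
      arcs-b≡2 : ∀ k → b ≢ k → arcs Γ b k ≡ 2
      arcs-b≡2 k b≢k with a ≟ k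
      ... | yes refl = trans (arcs-comm Γ b a) arcs≡2
      ... | no  a≢k  = trans (arcs-comm Γ b k) (ℕₚ.+-cancelˡ-≡ (d k) _ _
              (trans d-k (cong (ℕ._+ 2) (sym d-k≡))))
        where
        d-k : d k ℕ.+ arcs Γ k b ≡ suc (d b) ℕ.+ 2
        d-k = trans (d+arcs-const (b≢k ∘ sym) (b≢a ∘ sym)) (cong₂ ℕ._+_ d-a arcs≡2)
        d-k≡ : d k ≡ suc (d b)
        d-k≡ = degrees-differ-by-1 (ℕₚ.+-cancelʳ-≤ 2 _ _
          (ℕₚ.≤-trans (ℕₚ.≤-reflexive (sym d-k)) (ℕₚ.+-monoʳ-≤ (d k) (arcs≤2 Γ k b))))
      d-a≡n : d a ≡ size {n} (λ _ → true)
      d-a≡n = begin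
        d a                                        ≡⟨ d-a ⟩
        suc (d b)                                  ≡⟨ cong suc (d⁺≡size Γ b) ⟩
        suc (size (edge Γ b))                      ≡⟨ ℕₚ.+-comm 1 _ ⟩
        size (edge Γ b) ℕ.+ 1                      ≡⟨ ∑-agree-off b (toℕ ∘ edge Γ b) (λ _ → 1)
            (λ k b≢k → cong toℕ (arcs≡2⇒edge Γ b k (arcs-b≡2 k b≢k))) ⟩
        size {n} (λ _ → true) ℕ.+ toℕ (edge Γ b b) ≡⟨ cong (λ c → size {n} (λ _ → true) ℕ.+ toℕ c) (noLoop Γ b) ⟩
        size {n} (λ _ → true) ℕ.+ 0                ≡⟨ ℕₚ.+-identityʳ _ ⟩
        size {n} (λ _ → true)                      ∎
        where open ≡-Reasoning

    arcs≡1 : arcs Γ a b ≡ 1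
    arcs≡1 with arcs-values Γ a b
    ... | inj₁ eq        = contradiction eq arcs≢0
    ... | inj₂ (inj₁ eq) = eq
    ... | inj₂ (inj₂ eq) = contradiction eq arcs≢2

    -- Since one arc joins a and b, d k + arcs k b = d b + 2 for every other k. At most two arcs are
    -- available, so no degree lies below d b.
    two-degrees : ∀ k → d k ≢ d b → d k ≡ suc (d b)
    two-degrees k d-k≢d-b with a ≟ k | b ≟ k
    ... | yes refl | _        = d-a
    ... | no  _    | yes refl = contradiction refl d-k≢d-b
    ... | no  a≢k  | no  b≢k  = degrees-differ-by-1 (ℕₚ.≤∧≢⇒< d-b≤d-k (d-k≢d-b ∘ sym))
      where
      d-k : d k ℕ.+ arcs Γ k b ≡ d b ℕ.+ 2
      d-k = trans (d+arcs-const (b≢k ∘ sym) (b≢a ∘ sym))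
        (trans (cong₂ ℕ._+_ d-a arcs≡1) (sym (ℕₚ.+-suc (d b) 1)))
      d-b≤d-k : d b ℕ.≤ d k
      d-b≤d-k = ℕₚ.+-cancelʳ-≤ 2 _ _
        (ℕₚ.≤-trans (ℕₚ.≤-reflexive (sym d-k)) (ℕₚ.+-monoʳ-≤ (d k) (arcs≤2 Γ k b)))

    -- The pair a, b fixes the constant weight at 2 (d b) + 2. Subtracting degrees leaves 2, 1 or 0
    -- arcs, according to whether none, one or both of the two vertices have the higher degree.
    weight-ab : ∀ i j → i ≢ j → d i ℕ.+ d j ℕ.+ arcs Γ i j ≡ suc (d b) ℕ.+ d b ℕ.+ 1
    weight-ab i j i≢j = trans (weight≡w i j i≢j) (trans (sym (weight≡w a b (b≢a ∘ sym)))
      (cong₂ ℕ._+_ (cong (ℕ._+ d b) d-a) arcs≡1))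

    arcs-low-low : ∀ {i j} → i ≢ j → d i ≡ d b → d j ≡ d b → arcs Γ i j ≡ 2
    arcs-low-low {i} {j} i≢j dᵢ dⱼ = ℕₚ.+-cancelˡ-≡ (d b ℕ.+ d b) _ _
      (trans (sym (cong (ℕ._+ arcs Γ i j) (cong₂ ℕ._+_ dᵢ dⱼ))) (trans (weight-ab i j i≢j)
        (sym (ℕₚ.+-suc (d b ℕ.+ d b) 1))))

    arcs-high-low : ∀ {i j} → i ≢ j → d i ≡ suc (d b) → d j ≡ d b → arcs Γ i j ≡ 1
    arcs-high-low {i} {j} i≢j dᵢ dⱼ = ℕₚ.+-cancelˡ-≡ (suc (d b) ℕ.+ d b) _ _
      (trans (sym (cong (ℕ._+ arcs Γ i j) (cong₂ ℕ._+_ dᵢ dⱼ))) (weight-ab i j i≢j))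

    arcs-high-high : ∀ {i j} → i ≢ j → d i ≡ suc (d b) → d j ≡ suc (d b) → arcs Γ i j ≡ 0
    arcs-high-high {i} {j} i≢j dᵢ dⱼ = ℕₚ.+-cancelˡ-≡ (suc (d b) ℕ.+ suc (d b)) _ _
      (trans (sym (cong (ℕ._+ arcs Γ i j) (cong₂ ℕ._+_ dᵢ dⱼ))) (trans (weight-ab i j i≢j)
        (trans (ℕₚ.+-comm _ 1) (trans (cong suc (sym (ℕₚ.+-suc (d b) (d b)))) (sym (ℕₚ.+-identityʳ _))))))

    -- The candidate for the complete part of the star.
    low : Fin n → Bool
    low k = does (d k ℕₚ.≟ d b)

    low⇒ : ∀ k → low k ≡ true → d k ≡ d b
    low⇒ k low-k = invert (subst (Reflects _) low-k (proof (d k ℕₚ.≟ d b)))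

    ¬low⇒ : ∀ k → low k ≡ false → d k ≡ suc (d b)
    ¬low⇒ k ¬low-k = two-degrees k λ eq →
      contradiction (trans (sym ¬low-k) (dec-true (d k ℕₚ.≟ d b) eq)) λ ()

    high-edges⊑low : ∀ {i} → d i ≡ suc (d b) → edge Γ i ⊑ low
    high-edges⊑low {i} dᵢ j i→j with low j in low-j
    ... | true  = refl
    ... | false = contradiction (trans (sym i→j) (arcs≡0⇒¬edge Γ i j
            (arcs-high-high (λ { refl → contradiction (trans (sym i→j) (noLoop Γ i)) λ () })
              dᵢ (¬low⇒ j low-j)))) λ ()

    -- Two arcs join b to each other low vertex. Hence the low vertices without b, collected in `p`,
    -- are among the d b out-neighbours of b.
    size-low≤ : size low ℕ.≤ suc (d b)
    size-low≤ = begin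
      size low                                   ≡⟨ ℕₚ.+-identityʳ _ ⟨
      size low ℕ.+ 0                             ≡⟨ cong (λ c → size low ℕ.+ toℕ c) p-b ⟨
      size low ℕ.+ toℕ (p b)                     ≡⟨ ∑-agree-off b (toℕ ∘ low) (toℕ ∘ p) (λ j → cong toℕ ∘ low≡p j) ⟩
      size p ℕ.+ toℕ (low b)                     ≤⟨ ℕₚ.+-mono-≤ (size-mono p⊑) (ℕₚ.≤-reflexive (cong toℕ (dec-true (d b ℕₚ.≟ d b) refl))) ⟩
      size (edge Γ b) ℕ.+ 1                      ≡⟨ ℕₚ.+-comm _ 1 ⟩
      suc (size (edge Γ b))                      ≡⟨ cong suc (d⁺≡size Γ b) ⟨
      suc (d b)                                  ∎
      where
      open ℕₚ.≤-Reasoning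
      p : Fin n → Bool
      p j = not (does (b ≟ j)) ∧ low j
      p-b : p b ≡ false
      p-b = cong (λ c → not c ∧ low b) (dec-true (b ≟ b) refl)
      low≡p : ∀ j → b ≢ j → low j ≡ p j
      low≡p j b≢j = sym (cong (λ c → not c ∧ low j) (dec-false (b ≟ j) b≢j))
      p⊑ : p ⊑ edge Γ b
      p⊑ j p-j with b ≟ j
      ... | no b≢j = arcs≡2⇒edge Γ b j (arcs-low-low b≢j refl (low⇒ j p-j))

    -- A high vertex has d b + 1 out-neighbours, all of them low, and there are at most d b + 1 low
    -- vertices; so none is missed.
    high-edges≡low : ∀ {i} → d i ≡ suc (d b) → ∀ j → edge Γ i j ≡ low j
    high-edges≡low {i} dᵢ j with edge Γ i j in i→j | low j in low-j
    ... | true  | true  = refl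
    ... | false | false = refl
    ... | true  | false = trans (sym (high-edges⊑low dᵢ j i→j)) low-j
    ... | false | true  = trans (sym i→j) (⊑-antisym-size (high-edges⊑low dᵢ)
          (ℕₚ.≤-trans size-low≤ (ℕₚ.≤-reflexive (trans (sym dᵢ) (d⁺≡size Γ i)))) j low-j)

    unequalDegrees⇒starSet : StarSet Γ low
    unequalDegrees⇒starSet i j i≢j with low i in low-i
    ... | false = high-edges≡low (¬low⇒ i low-i) j
    ... | true with low j in low-j
    ...   | true  = arcs≡2⇒edge Γ i j (arcs-low-low i≢j (low⇒ i low-i) (low⇒ j low-j))
    -- The single arc between i and j runs from the high j to the low i, so there is none from i to
    -- j.
    ...   | false = trans
      (arcs≡1⇒opposite Γ i j (trans (arcs-comm Γ i j)
        (arcs-high-low (i≢j ∘ sym) (¬low⇒ j low-j) (low⇒ i low-i))))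
      (cong not (trans (high-edges≡low (¬low⇒ j low-j) i) low-i))

  classification : 2 ≤ℕ n → ∃ (StarSet Γ) ⊎ IsRegularTournament Γ
  classification (ℕ.s≤s (ℕ.s≤s _)) with all? (λ i → d i ℕₚ.≟ d zero)
  ... | no ¬equal with ¬∀⟶∃¬ n _ (λ i → d i ℕₚ.≟ d zero) ¬equal
  ...   | i , dᵢ≢d₀ with ℕₚ.<-cmp (d i) (d zero)
  ...     | tri< lt _ _ = inj₁ (_ , unequalDegrees⇒starSet lt)
  ...     | tri≈ _ eq _ = contradiction eq dᵢ≢d₀
  ...     | tri> _ _ gt = inj₁ (_ , unequalDegrees⇒starSet gt)
  classification 2≤n@(ℕ.s≤s (ℕ.s≤s _)) | yes dᵢ≡d₀ = by-arcs (arcs-values Γ zero (suc zero))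
    where
    arcs-const : ∀ i j → i ≢ j → arcs Γ i j ≡ arcs Γ zero (suc zero)
    arcs-const i j i≢j = ℕₚ.+-cancelˡ-≡ (d zero ℕ.+ d zero) _ _
      (trans (at i j i≢j) (sym (at zero (suc zero) λ ())))
      where
      at : ∀ i j → i ≢ j → d zero ℕ.+ d zero ℕ.+ arcs Γ i j ≡ w
      at i j i≢j = trans (sym (cong (ℕ._+ arcs Γ i j) (cong₂ ℕ._+_ (dᵢ≡d₀ i) (dᵢ≡d₀ j)))) (weight≡w i j i≢j)
    by-arcs : arcs Γ zero (suc zero) ≡ 0 ⊎ arcs Γ zero (suc zero) ≡ 1 ⊎ arcs Γ zero (suc zero) ≡ 2 →
      ∃ (StarSet Γ) ⊎ IsRegularTournament Γ
    -- Empty and complete digraphs are the extreme star sets, with B empty and B everything.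
    by-arcs (inj₁ eq) = inj₁ ((λ _ → false) , λ i j i≢j →
      arcs≡0⇒¬edge Γ i j (trans (arcs-const i j i≢j) eq))
    by-arcs (inj₂ (inj₁ eq)) = inj₂ (equalDegrees⇒regular Γ (d zero) 2≤n
      (λ i j i≢j → arcs≡1⇒opposite Γ i j (trans (arcs-const i j i≢j) eq)) dᵢ≡d₀)
    by-arcs (inj₂ (inj₂ eq)) = inj₁ ((λ _ → true) , λ i j i≢j →
      arcs≡2⇒edge Γ i j (trans (arcs-const i j i≢j) eq))

-- Imploding stars

isSecond : {A B : Set} → A ⊎ B → Bool
isSecond (inj₁ _) = false
isSecond (inj₂ _) = true

isSecond-map : {A B C D : Set} (g : A → C) (h : B → D) (v : A ⊎ B) →
  isSecond (map g h v) ≡ isSecond v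
isSecond-map g h (inj₁ _) = refl
isSecond-map g h (inj₂ _) = refl

-- Vertices of the second part receive arcs from the first part by the join and from each other by
-- completeness; vertices of the first part receive none. So only the head of an arc matters.
implodingStar-edge : ∀ n k {u v} → u ≢ v →
  edge (implodingStar n k) u v ≡ isSecond (splitAt (n ℕ.∸ k) v)
implodingStar-edge n k {u} {v} u≢v
  with splitAt (n ℕ.∸ k) u in eqᵤ | splitAt (n ℕ.∸ k) v in eqᵥ
... | inj₁ _ | inj₁ _ = refl
... | inj₁ _ | inj₂ _ = refl
... | inj₂ _ | inj₁ _ = refl
... | inj₂ x | inj₂ y = cong not (dec-false (x ≟ y) λ { refl →
  u≢v (trans (sym (splitAt⁻¹-↑ʳ {m = n ℕ.∸ k} eqᵤ)) (splitAt⁻¹-↑ʳ {m = n ℕ.∸ k} eqᵥ)) })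

-- Moves the vertices of B behind the others, with vertex 0 put in front of the block to which
-- `B zero` assigns it. The block sizes are tied by an equation rather than written as n ∸ k, so the
-- recursion only adds one to `c` or to `k`.
sortBy : ∀ n (B : Fin n → Bool) → ∃₂ λ c k → c ℕ.+ k ≡ n ×
  Σ (Fin n ↔ (Fin c ⊎ Fin k)) λ f → ∀ i → isSecond (Inverse.to f i) ≡ B i
sortBy zero B = 0 , 0 , refl , mk↔ₛ′ (λ ()) (λ { (inj₁ ()) ; (inj₂ ()) })
  (λ { (inj₁ ()) ; (inj₂ ()) }) (λ ()) , λ ()
sortBy (suc n) B with sortBy n (B ∘ suc) | B zero in eq
... | c , k , refl , f , second | false = suc c , k , refl , mk↔ₛ′ to from to∘from from∘to , second′
  where
  open Inverse f using (strictlyInverseˡ; strictlyInverseʳ) renaming (to to fto; from to ffrom)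
  to : Fin (suc n) → Fin (suc c) ⊎ Fin k
  to zero    = inj₁ zero
  to (suc i) = map₁ suc (fto i)
  from : Fin (suc c) ⊎ Fin k → Fin (suc n)
  from (inj₁ zero)    = zero
  from (inj₁ (suc x)) = suc (ffrom (inj₁ x))
  from (inj₂ y)       = suc (ffrom (inj₂ y))
  to∘from : ∀ v → to (from v) ≡ v
  to∘from (inj₁ zero)    = refl
  to∘from (inj₁ (suc x)) = cong (map₁ suc) (strictlyInverseˡ (inj₁ x))
  to∘from (inj₂ y)       = cong (map₁ suc) (strictlyInverseˡ (inj₂ y))
  from∘map₁ : ∀ v → from (map₁ suc v) ≡ suc (ffrom v)
  from∘map₁ (inj₁ _) = refl
  from∘map₁ (inj₂ _) = refl
  from∘to : ∀ i → from (to i) ≡ i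
  from∘to zero    = refl
  from∘to (suc i) = trans (from∘map₁ (fto i)) (cong suc (strictlyInverseʳ i))
  second′ : ∀ i → isSecond (to i) ≡ B i
  second′ zero    = sym eq
  second′ (suc i) = trans (isSecond-map suc id (fto i)) (second i)
... | c , k , refl , f , second | true = c , suc k , ℕₚ.+-suc c k , mk↔ₛ′ to from to∘from from∘to , second′
  where
  open Inverse f using (strictlyInverseˡ; strictlyInverseʳ) renaming (to to fto; from to ffrom)
  to : Fin (suc n) → Fin c ⊎ Fin (suc k)
  to zero    = inj₂ zero
  to (suc i) = map₂ suc (fto i)
  from : Fin c ⊎ Fin (suc k) → Fin (suc n)
  from (inj₂ zero)    = zero
  from (inj₂ (suc y)) = suc (ffrom (inj₂ y))
  from (inj₁ x)       = suc (ffrom (inj₁ x))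
  to∘from : ∀ v → to (from v) ≡ v
  to∘from (inj₂ zero)    = refl
  to∘from (inj₂ (suc y)) = cong (map₂ suc) (strictlyInverseˡ (inj₂ y))
  to∘from (inj₁ x)       = cong (map₂ suc) (strictlyInverseˡ (inj₁ x))
  from∘map₂ : ∀ v → from (map₂ suc v) ≡ suc (ffrom v)
  from∘map₂ (inj₁ _) = refl
  from∘map₂ (inj₂ _) = refl
  from∘to : ∀ i → from (to i) ≡ i
  from∘to zero    = refl
  from∘to (suc i) = trans (from∘map₂ (fto i)) (cong suc (strictlyInverseʳ i))
  second′ : ∀ i → isSecond (to i) ≡ B i
  second′ zero    = sym eq
  second′ (suc i) = trans (isSecond-map id suc (fto i)) (second i)

implodingStar⇒starSet : (Γ : Digraph n) → IsImplodingStar Γ → ∃ (StarSet Γ)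
implodingStar⇒starSet {n} Γ (k , _ , f , edge≡) =
  isSecond ∘ splitAt (n ℕ.∸ k) ∘ Inverse.to f , λ i j i≢j →
    trans (edge≡ i j) (implodingStar-edge n k (i≢j ∘ injective))
  where
  open Injection (↔⇒↣ f) using (injective)

starSet⇒implodingStar : (Γ : Digraph n) → ∃ (StarSet Γ) → IsImplodingStar Γ
starSet⇒implodingStar {n} Γ (B , star) with sortBy n B
... | c , k , c+k≡n , sorted , second = k , k≤n , π , edge≡
  where
  c≡n∸k : c ≡ n ℕ.∸ k
  c≡n∸k = trans (sym (ℕₚ.m+n∸n≡m c k)) (cong (ℕ._∸ k) c+k≡n)
  k≤n : k ≤ℕ n
  k≤n = subst (k ≤ℕ_) c+k≡n (ℕₚ.m≤n+m k c)
  sorted′ : Σ (Fin n ↔ (Fin (n ℕ.∸ k) ⊎ Fin k)) λ f → ∀ i → isSecond (Inverse.to f i) ≡ B i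
  sorted′ = subst (λ c → Σ (Fin n ↔ (Fin c ⊎ Fin k)) λ f → ∀ i → isSecond (Inverse.to f i) ≡ B i)
    -- The bijection and its property are transported together, so that the property still speaks of
    -- the transported bijection.
    c≡n∸k (sorted , second)
  π : Fin n ↔ Fin (n ℕ.∸ k ℕ.+ k)
  π = ↔-sym +↔⊎ ↔-∘ proj₁ sorted′
  open Injection (↔⇒↣ π) using (injective)
  edge≡ : ∀ i j → edge Γ i j ≡ edge (implodingStar n k) (Inverse.to π i) (Inverse.to π j)
  edge≡ i j with i ≟ j
  ... | yes refl = trans (noLoop Γ i) (sym (noLoop (implodingStar n k) (Inverse.to π i)))
  ... | no  i≢j  = trans (star i j i≢j) (trans (sym (proj₂ sorted′ j))
    (sym (trans (implodingStar-edge n k (i≢j ∘ injective))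
      (cong isSecond (splitAt-join (n ℕ.∸ k) k (Inverse.to (proj₁ sorted′) j))))))

corollary3p2 : ∀ (n : ℕ) → 2 ≤ℕ n → (Γ : Digraph n) →
    IsSpread Γ 0ℝ ⇔ (IsImplodingStar Γ ⊎ IsRegularTournament Γ)
corollary3p2 n 2≤n Γ = mk⇔ forward backward
  where
  forward : IsSpread Γ 0ℝ → IsImplodingStar Γ ⊎ IsRegularTournament Γ
  forward sp = let w , weight≡w = spread≈0⇒constantWeight Γ 2≤n sp in
    map₁ (starSet⇒implodingStar Γ) (classification Γ w weight≡w 2≤n)
  backward : IsImplodingStar Γ ⊎ IsRegularTournament Γ → IsSpread Γ 0ℝ
  backward (inj₁ star) = constantWeight⇒spread≈0 Γ 2≤n
    (starSet⇒constantWeight Γ (proj₂ (implodingStar⇒starSet Γ star)))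
  backward (inj₂ tour) = constantWeight⇒spread≈0 Γ 2≤n
    (regularTournament⇒constantWeight Γ tour)
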